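{- Let $G=(V,E)$ be a connected finite simple graph, let $u\in V$, let $t>0$ be an integer, let $0\leq\varepsilon\leq 1$, and let $S$ be a set of trajectories of length $t$ from $u$. Let $p_{u,S}$ be the probability that the trajectory of a simple random walk started from $u$ and run for $t$ steps is a member of $S$. Then there exists a strategy for the $\varepsilon$-time-biased random walk ($\varepsilon$-TBRW) such that the probability $q_{u,S}(\varepsilon)$ that the trajectory of the $\varepsilon$-TBRW started from $u$ and run for $t$ steps under this strategy is a member of $S$ satisfies \[ q_{u,S}(\varepsilon)\ \geq\ \left(p_{u,S}\right)^{1-\varepsilon}. \]
   Context: A trajectory of length $t$ from $u$ is a sequence of vertices $(x_0,x_1,\dots,x_t)$ with $x_0=u$ and $x_{i-1}x_i\in E$ for all $1\le i\le t$. The simple random walk (SRW) moves at each step to a uniformly random neighbour of its current vertex (it is not lazy). The $\varepsilon$-time-biased random walk ($\varepsilon$-TBRW) is the following controlled (non-lazy) process: at each step, independently of the past, with probability $1-\varepsilon$ the walk moves to a uniformly random neighbour of the current vertex, and with probability $\varepsilon$ it moves to a neighbour of the current vertex chosen by a controller. The controller's choice may be randomised (a probability distribution on the neighbours) and may depend on the graph, the time and the whole history $X_0,\dots,X_t$ of the walk; the rule used is called a strategy. Convention: $0^0=0$ (relevant only if $\varepsilon=1$ and $S=\emptyset$). -}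

module Defs where

open import Algebra.Bundles using (CommutativeRing; RawSemiring)
import Algebra.Definitions.RawSemiring as RawSemiringDefs
import Algebra.Properties.CommutativeSemiring.Exp as Exp
open import Data.Bool.Base using (if_then_else_)
open import Data.Fin.Base as Fin using (Fin)
import Data.Fin.Properties as Finₚ
open import Data.Integer.Base as ℤ using (+_)
import Data.Integer.Properties as ℤₚ
open import Data.List.Base using (List; length; filter; allFin)
open import Data.Nat.Base as ℕ using (ℕ; zero; suc; z≤n; s≤s)
import Data.Nat.Properties as ℕₚ
import Data.Nat.Solver as ℕSolver
open import Data.Product using (∃-syntax; _×_; _,_; proj₁; proj₂)
open import Data.Rational.Base
open import Data.Rational.Properties
open import Data.Rational.Solver using (module +-*-Solver)
open import Data.Rational.Unnormalised.Base as ℚᵘ using (mkℚᵘ; *≤*; *≡*)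
import Data.Rational.Unnormalised.Properties as ℚᵘₚ
open import Data.Sum.Base using (inj₁; inj₂)
open import Data.Vec.Base using (Vec; []; _∷_; head; init; last; lookup)
open import Level using (0ℓ)
open import Relation.Binary.Construct.Closure.ReflexiveTransitive using (Star)
import Relation.Binary.Core as Binary
import Relation.Binary.Definitions as Binary
open import Relation.Binary.PropositionalEquality
open import Relation.Nullary using (yes; no; does; ¬_; contradiction)
open import Relation.Unary using (Pred; Decidable)

open RawSemiringDefs +-*-rawSemiring using (_^_)
open Exp (CommutativeRing.commutativeSemiring +-*-commutativeRing)
  using (^-homo-*; ^-assocʳ; ^-distrib-*; ^-congʳ)

open +-*-Solver using (solve; _:=_; _:+_; _:*_; _:-_; :-_; con)

*-mono-≤ : ∀ {a b c d} → 0ℚ ≤ a → 0ℚ ≤ c → a ≤ b → c ≤ d → a * c ≤ b * d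
*-mono-≤ {a} {b} {c} {d} 0≤a 0≤c a≤b c≤d = ≤-trans
  (*-monoʳ-≤-nonNeg c {{nonNegative 0≤c}} a≤b)
  (*-monoˡ-≤-nonNeg b {{nonNegative (≤-trans 0≤a a≤b)}} c≤d)

*-nonneg : ∀ {a b} → 0ℚ ≤ a → 0ℚ ≤ b → 0ℚ ≤ a * b
*-nonneg {a} {b} 0≤a 0≤b = subst (_≤ a * b) (*-zeroʳ a)
  (*-monoˡ-≤-nonNeg a {{nonNegative 0≤a}} 0≤b)

*-pos : ∀ {a b} → 0ℚ < a → 0ℚ < b → 0ℚ < a * b
*-pos {a} {b} 0<a 0<b = subst (_< a * b) (*-zeroʳ a)
  (*-monoʳ-<-pos a {{positive 0<a}} 0<b)

+-nonneg : ∀ {a b} → 0ℚ ≤ a → 0ℚ ≤ b → 0ℚ ≤ a + b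
+-nonneg = +-mono-≤

≤+ʳ : ∀ {a b} → 0ℚ ≤ b → a ≤ a + b
≤+ʳ {a} {b} 0≤b = subst (_≤ a + b) (+-identityʳ a) (+-monoʳ-≤ a 0≤b)

≤+ˡ : ∀ {a b} → 0ℚ ≤ b → a ≤ b + a
≤+ˡ {a} {b} 0≤b = subst (_≤ b + a) (+-identityˡ a) (+-monoˡ-≤ a 0≤b)

0≤1 : 0ℚ ≤ 1ℚ
0≤1 = nonNegative⁻¹ 1ℚ

0<1 : 0ℚ < 1ℚ
0<1 = positive⁻¹ 1ℚ

½+½ : ∀ δ → ½ * δ + ½ * δ ≡ δ
½+½ δ = trans (sym (*-distribʳ-+ δ ½ ½)) (*-identityˡ δ)

half-pos : ∀ {δ} → 0ℚ < δ → 0ℚ < ½ * δ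
half-pos = *-pos (positive⁻¹ ½)

≤∣∣ : ∀ p → p ≤ ∣ p ∣
≤∣∣ p with ≤-total 0ℚ p
... | inj₁ 0≤p = ≤-reflexive (sym (0≤p⇒∣p∣≡p 0≤p))
... | inj₂ p≤0 = ≤-trans p≤0 (0≤∣p∣ p)

∣∣-lub : ∀ {p q} → p ≤ q → - p ≤ q → ∣ p ∣ ≤ q
∣∣-lub {p} {q} p≤q -p≤q with ∣p∣≡p∨∣p∣≡-p p
... | inj₁ e = subst (_≤ q) (sym e) p≤q
... | inj₂ e = subst (_≤ q) (sym e) -p≤q

∣-∣-sym : ∀ p q → ∣ p - q ∣ ≡ ∣ q - p ∣
∣-∣-sym p q = trans (sym (∣-p∣≡∣p∣ (p - q)))
  (cong ∣_∣ (solve 2 (λ p q → :- (p :- q) := q :- p) refl p q))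

near⇒≤ : ∀ {p q δ} → ∣ p - q ∣ ≤ δ → p ≤ q + δ
near⇒≤ {p} {q} {δ} h = subst (_≤ q + δ)
  (solve 2 (λ p q → q :+ (p :- q) := p) refl p q)
  (+-monoʳ-≤ q (≤-trans (≤∣∣ (p - q)) h))

≤⇒near : ∀ {p q δ} → p ≤ q + δ → q ≤ p + δ → ∣ p - q ∣ ≤ δ
≤⇒near {p} {q} {δ} h k = ∣∣-lub
  (subst (p - q ≤_) (solve 2 (λ q δ → q :+ δ :- q := δ) refl q δ) (+-monoˡ-≤ (- q) h))
  (subst₂ _≤_ (solve 2 (λ p q → q :- p := :- (p :- q)) refl p q)
     (solve 2 (λ p δ → p :+ δ :- p := δ) refl p δ) (+-monoˡ-≤ (- p) k))

^-nonneg : ∀ {x} n → 0ℚ ≤ x → 0ℚ ≤ x ^ n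
^-nonneg zero    0≤x = 0≤1
^-nonneg (suc n) 0≤x = *-nonneg 0≤x (^-nonneg n 0≤x)

^-mono-≤ : ∀ {x y} n → 0ℚ ≤ x → x ≤ y → x ^ n ≤ y ^ n
^-mono-≤ zero    0≤x x≤y = ≤-refl
^-mono-≤ (suc n) 0≤x x≤y = *-mono-≤ 0≤x (^-nonneg n 0≤x) x≤y (^-mono-≤ n 0≤x x≤y)

1≤^ : ∀ {x} n → 1ℚ ≤ x → 1ℚ ≤ x ^ n
1≤^ zero    1≤x = ≤-refl
1≤^ {x} (suc n) 1≤x = subst (_≤ x * x ^ n) (*-identityˡ 1ℚ) (*-mono-≤ 0≤1 0≤1 1≤x (1≤^ n 1≤x))

^-pos : ∀ {x} n → 0ℚ < x → 0ℚ < x ^ n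
^-pos zero    0<x = 0<1
^-pos (suc n) 0<x = *-pos 0<x (^-pos n 0<x)

^-mono-< : ∀ {x y} n → 0ℚ ≤ x → x < y → x ^ suc n < y ^ suc n
^-mono-< {x} {y} n 0≤x x<y = ≤-<-trans
  (*-monoˡ-≤-nonNeg x {{nonNegative 0≤x}} (^-mono-≤ n 0≤x (<⇒≤ x<y)))
  (*-monoˡ-<-pos (y ^ n) {{positive (^-pos n (≤-<-trans 0≤x x<y))}} x<y)

^-cancel-≤ : ∀ {x y} n .{{_ : ℕ.NonZero n}} → 0ℚ ≤ y → x ^ n ≤ y ^ n → x ≤ y
^-cancel-≤ {x} {y} (suc n) 0≤y h with x ≤? y
... | yes x≤y = x≤y
... | no  x≰y = contradiction (<-≤-trans (^-mono-< n 0≤y (≰⇒> x≰y)) h) (<-irrefl refl)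

1≤y⇒y≤y^ : ∀ {y} n .{{_ : ℕ.NonZero n}} → 1ℚ ≤ y → y ≤ y ^ n
1≤y⇒y≤y^ {y} (suc n) 1≤y = subst (_≤ y * y ^ n) (*-identityʳ y)
  (*-monoˡ-≤-nonNeg y {{nonNegative (≤-trans 0≤1 1≤y)}} (1≤^ n 1≤y))

fromℕ : ℕ → ℚ
fromℕ k = + k / 1

toℚᵘ-/ : ∀ k n → toℚᵘ (+ k / suc n) ℚᵘ.≃ mkℚᵘ (+ k) n
toℚᵘ-/ k n = toℚᵘ-fromℚᵘ (mkℚᵘ (+ k) n)

/-suc : ∀ k n → + suc k / suc n ≡ + k / suc n + + 1 / suc n
/-suc k n = toℚᵘ-injective (ℚᵘₚ.≃-trans (toℚᵘ-/ (suc k) n)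
  (ℚᵘₚ.≃-trans (*≡* e) (ℚᵘₚ.≃-sym (ℚᵘₚ.≃-trans (toℚᵘ-homo-+ (+ k / suc n) (+ 1 / suc n))
    (ℚᵘₚ.+-cong (toℚᵘ-/ k n) (toℚᵘ-/ 1 n))))))
  where
  open ℕSolver.+-*-Solver using () renaming (solve to solveℕ; _:=_ to _⩵_; _:+_ to _⊕_; _:*_ to _⊛_; con to c)
  e : + suc k ℤ.* (+ (suc n ℕ.* suc n)) ≡ (+ k ℤ.* + suc n ℤ.+ + 1 ℤ.* + suc n) ℤ.* + suc n
  e rewrite sym (ℤₚ.pos-* k (suc n)) | sym (ℤₚ.pos-* 1 (suc n))
    | sym (ℤₚ.pos-* (suc k) (suc n ℕ.* suc n))
    | sym (ℤₚ.pos-* (k ℕ.* suc n ℕ.+ 1 ℕ.* suc n) (suc n))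
    = cong +_ (solveℕ 2 (λ k m → (c 1 ⊕ k) ⊛ (m ⊛ m) ⩵ (k ⊛ m ⊕ c 1 ⊛ m) ⊛ m) refl k (suc n))

/-mono : ∀ {j k m n} → j ℕ.* suc n ℕ.≤ k ℕ.* suc m → + j / suc m ≤ + k / suc n
/-mono {j} {k} {m} {n} h = toℚᵘ-cancel-≤ (ℚᵘₚ.≤-respˡ-≃ (ℚᵘₚ.≃-sym (toℚᵘ-/ j m))
  (ℚᵘₚ.≤-respʳ-≃ (ℚᵘₚ.≃-sym (toℚᵘ-/ k n)) (*≤* (subst₂ ℤ._≤_ (ℤₚ.pos-* j (suc n)) (ℤₚ.pos-* k (suc m)) (ℤ.+≤+ h)))))

0≤/ : ∀ k n → 0ℚ ≤ + k / suc n
0≤/ k n = /-mono {0} {k} {0} {n} z≤n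

bernoulli : ∀ {h} n → 0ℚ ≤ h → 1ℚ + fromℕ n * h ≤ (1ℚ + h) ^ n
bernoulli {h} zero 0≤h = ≤-reflexive (trans (cong (_+_ 1ℚ) (*-zeroˡ h)) (+-identityʳ 1ℚ))
bernoulli {h} (suc n) 0≤h = ≤-trans
  (subst₂ _≤_
     (trans (solve 2 (λ h m → con 1ℚ :+ (m :* h :+ h) := con 1ℚ :+ (m :+ con 1ℚ) :* h) refl h (fromℕ n))
       (cong (λ z → 1ℚ + z * h) (sym (/-suc n 0))))
     (solve 2 (λ h m → (con 1ℚ :+ (m :* h :+ h)) :+ (h :* (m :* h)) := (con 1ℚ :+ h) :* (con 1ℚ :+ m :* h)) refl h (fromℕ n))
     (≤+ʳ (*-nonneg 0≤h (*-nonneg (0≤/ n 0) 0≤h))))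
  (*-monoˡ-≤-nonNeg (1ℚ + h) {{nonNegative (+-nonneg 0≤1 0≤h)}} (bernoulli n 0≤h))

≤fromℕ : ∀ q → q ≤ fromℕ ℤ.∣ ↥ q ∣
≤fromℕ q@(mkℚ (+ a) d _) = subst (_≤ fromℕ a) (↥p/↧p≡p q) (/-mono {a} {a} {d} {0} (ℕₚ.*-monoʳ-≤ a (s≤s z≤n)))
≤fromℕ q@(mkℚ ℤ.-[1+ a ] d _) = ≤-trans (<⇒≤ (negative⁻¹ q)) (0≤/ (suc a) 0)

fromℕ-mono : ∀ {j k} → j ℕ.≤ k → fromℕ j ≤ fromℕ k
fromℕ-mono {j} {k} h = /-mono {j} {k} {0} {0} (ℕₚ.*-monoˡ-≤ 1 h)

/-as-* : ∀ k n → + k / suc n ≡ fromℕ k * (+ 1 / suc n)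
/-as-* zero n = trans (0/n≡0 (suc n)) (sym (*-zeroˡ (+ 1 / suc n)))
/-as-* (suc k) n = trans (/-suc k n) (trans (cong (_+ + 1 / suc n) (/-as-* k n))
  (trans (solve 2 (λ k e → k :* e :+ e := (k :+ con 1ℚ) :* e) refl (fromℕ k) (+ 1 / suc n))
    (cong (_* (+ 1 / suc n)) (sym (/-suc k 0)))))

n/n : ∀ n → + suc n / suc n ≡ 1ℚ
n/n n = ≤-antisym (/-mono {suc n} {1} {n} {0} (ℕₚ.≤-reflexive (ℕₚ.*-comm (suc n) 1)))
  (/-mono {1} {suc n} {0} {n} (ℕₚ.≤-reflexive (ℕₚ.*-comm 1 (suc n))))

archimedes : ∀ q {h} → 0ℚ < h → ∃[ N ] q ≤ fromℕ (suc N) * h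
archimedes q {h} 0<h = N , subst (_≤ fromℕ (suc N) * h) e
    (*-monoʳ-≤-nonNeg h {{nonNegative (<⇒≤ 0<h)}} (≤-trans (≤fromℕ r) (fromℕ-mono (ℕₚ.n≤1+n N))))
  where
  instance
    h≢0 : NonZero h
    h≢0 = pos⇒nonZero h {{positive 0<h}}
  r = q * 1/ h
  N = ℤ.∣ ↥ r ∣
  e : r * h ≡ q
  e = trans (*-assoc q (1/ h) h) (trans (cong (q *_) (*-inverseˡ h)) (*-identityʳ q))

*-swapʳ : ∀ a b c → a * b * c ≡ (a * c) * b
*-swapʳ = solve 3 (λ a b c → a :* b :* c := (a :* c) :* b) refl

unit-small : ∀ {δ} → 0ℚ < δ → ∃[ N ] ∀ n → N ℕ.≤ n → + 1 / suc n ≤ δ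
unit-small {δ} 0<δ = N , λ n N≤n → ≤-trans (/-mono {1} {1} {n} {N} (ℕₚ.*-monoʳ-≤ 1 (s≤s N≤n)))
    (invert (fromℕ (suc N)) (+ 1 / suc N) s*e≡1 (0≤/ 1 N) (proj₂ A))
  where
  A = archimedes 1ℚ 0<δ
  N = proj₁ A
  s*e≡1 : fromℕ (suc N) * (+ 1 / suc N) ≡ 1ℚ
  s*e≡1 = trans (sym (/-as-* (suc N) N)) (n/n N)
  invert : ∀ s e → s * e ≡ 1ℚ → 0ℚ ≤ e → 1ℚ ≤ s * δ → e ≤ δ
  invert s e s*e≡1 0≤e h = subst₂ _≤_ (*-identityˡ e)
     (trans (*-swapʳ s δ e) (trans (cong (_* δ) s*e≡1) (*-identityˡ δ)))
     (*-monoʳ-≤-nonNeg e {{nonNegative 0≤e}} h)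

-- The order and equality of reals are the relations _≤ᴿ_ and _≈ᴿ_ below;
-- arithmetic is termwise.
IsCauchy : (ℕ → ℚ) → Set
IsCauchy x = ∀ {δ} → 0ℚ < δ → ∃[ N ] ∀ m n → N ℕ.≤ m → N ℕ.≤ n → ∣ x m - x n ∣ ≤ δ

record ℝ : Set where
  constructor mkℝ
  field
    seq    : ℕ → ℚ
    cauchy : IsCauchy seq

open ℝ public

infix 4 _≤ᴿ_ _≈ᴿ_

_≤ᴿ_ : ℝ → ℝ → Set
x ≤ᴿ y = ∀ {δ} → 0ℚ < δ → ∃[ N ] ∀ n → N ℕ.≤ n → seq x n ≤ seq y n + δ

_≈ᴿ_ : ℝ → ℝ → Set
x ≈ᴿ y = x ≤ᴿ y × y ≤ᴿ x

opaque
  const-cauchy : ∀ q → IsCauchy (λ _ → q)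
  const-cauchy q {δ} 0<δ = 0 , λ _ _ _ _ →
    subst (λ z → ∣ z ∣ ≤ δ) (sym (+-inverseʳ q)) (<⇒≤ 0<δ)

fromℚ : ℚ → ℝ
fromℚ q = mkℝ (λ _ → q) (const-cauchy q)

0ᴿ 1ᴿ : ℝ
0ᴿ = fromℚ 0ℚ
1ᴿ = fromℚ 1ℚ

infixl 6 _+ᴿ_ _-ᴿ_
infixl 7 _*ᴿ_
infix  8 -ᴿ_

opaque
  +-cauchy : ∀ x y → IsCauchy (λ n → seq x n + seq y n)
  +-cauchy x y {δ} 0<δ =
    let N₁ , c₁ = cauchy x (half-pos 0<δ)
        N₂ , c₂ = cauchy y (half-pos 0<δ)
    in N₁ ℕ.⊔ N₂ , λ m n m≥ n≥ →
      subst₂ _≤_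
        (cong ∣_∣ (solve 4 (λ a b c d → (a :- b) :+ (c :- d) := (a :+ c) :- (b :+ d)) refl
          (seq x m) (seq x n) (seq y m) (seq y n)))
        (½+½ δ)
        (≤-trans (∣p+q∣≤∣p∣+∣q∣ (seq x m - seq x n) (seq y m - seq y n))
          (+-mono-≤ (c₁ m n (ℕₚ.m⊔n≤o⇒m≤o N₁ N₂ m≥) (ℕₚ.m⊔n≤o⇒m≤o N₁ N₂ n≥))
                    (c₂ m n (ℕₚ.m⊔n≤o⇒n≤o N₁ N₂ m≥) (ℕₚ.m⊔n≤o⇒n≤o N₁ N₂ n≥))))

_+ᴿ_ : ℝ → ℝ → ℝ
x +ᴿ y = mkℝ (λ n → seq x n + seq y n) (+-cauchy x y)

opaque
  neg-cauchy : ∀ x → IsCauchy (λ n → - seq x n)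
  neg-cauchy x {δ} 0<δ =
    let N , c = cauchy x 0<δ
    in N , λ m n m≥ n≥ → subst (_≤ δ)
      (trans (sym (∣-p∣≡∣p∣ (seq x m - seq x n)))
        (cong ∣_∣ (solve 2 (λ a b → :- (a :- b) := (:- a) :- (:- b)) refl (seq x m) (seq x n))))
      (c m n m≥ n≥)

-ᴿ_ : ℝ → ℝ
-ᴿ x = mkℝ (λ n → - seq x n) (neg-cauchy x)

_-ᴿ_ : ℝ → ℝ → ℝ
x -ᴿ y = x +ᴿ (-ᴿ y)

eventually-bounded : ∀ x → ∃[ K ] 0ℚ < K × ∃[ N ] ∀ n → N ℕ.≤ n → ∣ seq x n ∣ ≤ K
eventually-bounded x =
  let N , c = cauchy x 0<1
  in ∣ seq x N ∣ + 1ℚ , ≤-<-trans (0≤∣p∣ (seq x N)) (subst (_< ∣ seq x N ∣ + 1ℚ) (+-identityʳ ∣ seq x N ∣) (+-monoʳ-< ∣ seq x N ∣ 0<1)) , N , λ n n≥ →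
    ≤-trans (≤-reflexive (cong ∣_∣ (solve 2 (λ a b → a := b :+ (a :- b)) refl (seq x n) (seq x N))))
      (≤-trans (∣p+q∣≤∣p∣+∣q∣ (seq x N) (seq x n - seq x N))
        (+-monoʳ-≤ ∣ seq x N ∣ (c n N n≥ ℕₚ.≤-refl)))

scale : ∀ {K δ} → 0ℚ < K → 0ℚ < δ → ∃[ η ] 0ℚ < η × K * η ≡ δ
scale {K} {δ} 0<K 0<δ = 1/ K * δ
  , *-pos (positive⁻¹ (1/ K) {{1/pos⇒pos K {{positive 0<K}}}}) 0<δ
  , trans (sym (*-assoc K (1/ K) δ)) (trans (cong (_* δ) (*-inverseʳ K)) (*-identityˡ δ))
  where
  instance
    K≢0 : NonZero K
    K≢0 = pos⇒nonZero K {{positive 0<K}}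

opaque
  *-cauchy : ∀ x y → IsCauchy (λ n → seq x n * seq y n)
  *-cauchy x y {δ} 0<δ =
    let K , 0<K , N₁ , bx = eventually-bounded x
        L , 0<L , N₂ , by = eventually-bounded y
        η , 0<η , Kη≡ = scale 0<K (half-pos 0<δ)
        θ , 0<θ , Lθ≡ = scale 0<L (half-pos 0<δ)
        N₃ , cy = cauchy y 0<η
        N₄ , cx = cauchy x 0<θ
        M = (N₁ ℕ.⊔ N₂) ℕ.⊔ (N₃ ℕ.⊔ N₄)
        ≥₁ = λ {k} (h : M ℕ.≤ k) → ℕₚ.m⊔n≤o⇒m≤o N₁ N₂ (ℕₚ.m⊔n≤o⇒m≤o (N₁ ℕ.⊔ N₂) (N₃ ℕ.⊔ N₄) h)
        ≥₂ = λ {k} (h : M ℕ.≤ k) → ℕₚ.m⊔n≤o⇒n≤o N₁ N₂ (ℕₚ.m⊔n≤o⇒m≤o (N₁ ℕ.⊔ N₂) (N₃ ℕ.⊔ N₄) h)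
        ≥₃ = λ {k} (h : M ℕ.≤ k) → ℕₚ.m⊔n≤o⇒m≤o N₃ N₄ (ℕₚ.m⊔n≤o⇒n≤o (N₁ ℕ.⊔ N₂) (N₃ ℕ.⊔ N₄) h)
        ≥₄ = λ {k} (h : M ℕ.≤ k) → ℕₚ.m⊔n≤o⇒n≤o N₃ N₄ (ℕₚ.m⊔n≤o⇒n≤o (N₁ ℕ.⊔ N₂) (N₃ ℕ.⊔ N₄) h)
    in M , λ m n m≥ n≥ →
      subst₂ _≤_
        (cong ∣_∣ (solve 4 (λ a b c d → a :* (c :- d) :+ d :* (a :- b) := a :* c :- b :* d) refl
          (seq x m) (seq x n) (seq y m) (seq y n)))
        (trans (cong₂ _+_ Kη≡ Lθ≡) (½+½ δ))
        (≤-trans (∣p+q∣≤∣p∣+∣q∣ (seq x m * (seq y m - seq y n)) (seq y n * (seq x m - seq x n)))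
          (+-mono-≤
            (subst (_≤ K * η) (sym (∣p*q∣≡∣p∣*∣q∣ (seq x m) (seq y m - seq y n)))
              (*-mono-≤ (0≤∣p∣ (seq x m)) (0≤∣p∣ (seq y m - seq y n)) (bx m (≥₁ m≥)) (cy m n (≥₃ m≥) (≥₃ n≥))))
            (subst (_≤ L * θ) (sym (∣p*q∣≡∣p∣*∣q∣ (seq y n) (seq x m - seq x n)))
              (*-mono-≤ (0≤∣p∣ (seq y n)) (0≤∣p∣ (seq x m - seq x n)) (by n (≥₂ n≥)) (cx m n (≥₄ m≥) (≥₄ n≥))))))

_*ᴿ_ : ℝ → ℝ → ℝ
x *ᴿ y = mkℝ (λ n → seq x n * seq y n) (*-cauchy x y)

greatest : ∀ {ℓ} {P : Pred ℕ ℓ} → Decidable P → ℕ → ℕ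
greatest P? zero    = zero
greatest P? (suc k) with P? (suc k)
... | yes _ = suc k
... | no  _ = greatest P? k

greatest-holds : ∀ {ℓ} {P : Pred ℕ ℓ} (P? : Decidable P) k → P 0 → P (greatest P? k)
greatest-holds P? zero    P0 = P0
greatest-holds P? (suc k) P0 with P? (suc k)
... | yes Pk = Pk
... | no  _  = greatest-holds P? k P0

greatest-maximal : ∀ {ℓ} {P : Pred ℕ ℓ} (P? : Decidable P) k → ¬ P (suc k) → ¬ P (suc (greatest P? k))
greatest-maximal P? zero    ¬P = ¬P
greatest-maximal P? (suc k) ¬P with P? (suc k)
... | yes _   = ¬P
... | no  ¬Pk = greatest-maximal P? k ¬Pk

-- The largest multiple of 1/(n+1) whose b-th power is at most x; the
-- search may stop at 1 + x rounded up, because b ≥ 1.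
opaque
  rootApprox : ℕ → (b : ℕ) (x : ℚ) → ℚ
  rootApprox n b x =
    + greatest (λ k → (+ k / suc n) ^ b ≤? x) (suc ℤ.∣ ↥ x ∣ ℕ.* suc n) / suc n

opaque
  unfolding rootApprox

  rootApprox-nonneg : ∀ n b x → 0ℚ ≤ rootApprox n b x
  rootApprox-nonneg n b x = 0≤/ (greatest (λ k → (+ k / suc n) ^ b ≤? x) (suc ℤ.∣ ↥ x ∣ ℕ.* suc n)) n

  rootApprox-lower : ∀ n b x .{{_ : ℕ.NonZero b}} → 0ℚ ≤ x → rootApprox n b x ^ b ≤ x
  rootApprox-lower n b@(suc b-1) x 0≤x =
    greatest-holds (λ k → (+ k / suc n) ^ b ≤? x) (suc ℤ.∣ ↥ x ∣ ℕ.* suc n)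
      (subst (_≤ x) (sym (trans (cong (_^ b) (0/n≡0 (suc n))) (*-zeroˡ (0ℚ ^ b-1)))) 0≤x)

  rootApprox-upper : ∀ n b x .{{_ : ℕ.NonZero b}} → x < (rootApprox n b x + + 1 / suc n) ^ b
  rootApprox-upper n b x = subst (λ z → x < z ^ b) (/-suc g n) (≰⇒> (greatest-maximal P? K ¬PK))
    where
    P? : Decidable (λ k → (+ k / suc n) ^ b ≤ x)
    P? k = (+ k / suc n) ^ b ≤? x
    a K g : ℕ
    a = ℤ.∣ ↥ x ∣
    K = suc a ℕ.* suc n
    g = greatest P? K
    y : ℚ
    y = + suc K / suc n
    a+1≤y : fromℕ (suc a) ≤ y
    a+1≤y = /-mono {suc a} {suc K} {0} {n}
      (ℕₚ.≤-trans (ℕₚ.n≤1+n K) (ℕₚ.≤-reflexive (sym (ℕₚ.*-identityʳ (suc K)))))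
    1≤y : 1ℚ ≤ y
    1≤y = ≤-trans (fromℕ-mono {1} {suc a} (s≤s z≤n)) a+1≤y
    x<y^b : x < y ^ b
    x<y^b = ≤-<-trans (≤fromℕ x) (<-≤-trans
      (subst₂ _<_ (+-identityʳ (fromℕ a)) (sym (/-suc a 0)) (+-monoʳ-< (fromℕ a) 0<1))
      (≤-trans a+1≤y (1≤y⇒y≤y^ b 1≤y)))
    ¬PK : ¬ (y ^ b ≤ x)
    ¬PK h = <-irrefl refl (<-≤-trans x<y^b h)

-- p ^ r for p > 0 and r ≥ 0 rational, rounded down to a multiple of 1/(n+1)
powApprox : ℕ → (p r : ℚ) → ℚ
powApprox n p r = rootApprox n (↧ₙ r) (p ^ ℤ.∣ ↥ r ∣)

module SlowlyVarying
  (z : ℕ → ℚ) (y : ℝ) (P : ℚ) (0≤P : 0ℚ ≤ P) (0≤z : ∀ n → 0ℚ ≤ z n)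
  (step : ∀ m n N {C} → ∣ seq y m - seq y n ∣ ≤ + 1 / suc N → 0ℚ ≤ C → P ≤ C ^ suc N →
    z m ≤ (z n + + 1 / suc n) * C)
  where

  bounded : ∀ N₀ → (∀ m n → N₀ ℕ.≤ m → N₀ ℕ.≤ n → ∣ seq y m - seq y n ∣ ≤ + 1 / 1) →
    ∃[ K ] 0ℚ < K × ∀ n → N₀ ℕ.≤ n → z n + + 1 / suc n ≤ K
  bounded N₀ near = w * P + 1ℚ
    , <-≤-trans 0<1 (≤+ˡ (*-nonneg (+-nonneg (0≤z N₀) (0≤/ 1 N₀)) 0≤P))
    , λ n n≥ → +-mono-≤
        (step n N₀ 0 (near n N₀ n≥ ℕₚ.≤-refl) 0≤P (≤-reflexive (sym (*-identityʳ P))))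
        (/-mono {1} {1} {n} {0} (s≤s z≤n))
    where
    w = z N₀ + + 1 / suc N₀

  close : ∀ {K h δ} m n N → ∣ seq y m - seq y n ∣ ≤ + 1 / suc N → 0ℚ ≤ h →
    P ≤ fromℕ (suc N) * h → z n + + 1 / suc n ≤ K → K * h ≡ ½ * δ → + 1 / suc n ≤ ½ * δ →
    z m ≤ z n + δ
  close {K} {h} {δ} m n N near 0≤h P≤ w≤K Kh≡ e≤ = begin
    z m                     ≤⟨ step m n N near (+-nonneg 0≤1 0≤h)
                                 (≤-trans P≤ (≤-trans (≤+ˡ 0≤1) (bernoulli (suc N) 0≤h))) ⟩
    w * (1ℚ + h)            ≡⟨ trans (*-distribˡ-+ w 1ℚ h) (cong (_+ w * h) (*-identityʳ w)) ⟩
    w + w * h               ≤⟨ +-monoʳ-≤ w (*-monoʳ-≤-nonNeg h {{nonNegative 0≤h}} w≤K) ⟩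
    w + K * h               ≡⟨ cong (_+_ w) Kh≡ ⟩
    w + ½ * δ               ≤⟨ +-monoˡ-≤ (½ * δ) (+-monoʳ-≤ (z n) e≤) ⟩
    z n + ½ * δ + ½ * δ     ≡⟨ trans (+-assoc (z n) (½ * δ) (½ * δ)) (cong (_+_ (z n)) (½+½ δ)) ⟩
    z n + δ                 ∎
    where
    open ≤-Reasoning
    w = z n + + 1 / suc n

  isCauchy : IsCauchy z
  isCauchy {δ} 0<δ =
    let N₀ , near₀      = cauchy y 0<1
        K , 0<K , w≤K   = bounded N₀ near₀
        h , 0<h , Kh≡   = scale 0<K (half-pos 0<δ)
        N , P≤          = archimedes P 0<h
        N₁ , near₁      = cauchy y (positive⁻¹ (+ 1 / suc N) {{normalize-pos 1 (suc N)}})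
        N₂ , small      = unit-small (half-pos 0<δ)
        ≥₀ = λ {k} (k≥ : N₀ ℕ.⊔ (N₁ ℕ.⊔ N₂) ℕ.≤ k) → ℕₚ.m⊔n≤o⇒m≤o N₀ (N₁ ℕ.⊔ N₂) k≥
        ≥₁ = λ {k} (k≥ : N₀ ℕ.⊔ (N₁ ℕ.⊔ N₂) ℕ.≤ k) → ℕₚ.m⊔n≤o⇒m≤o N₁ N₂ (ℕₚ.m⊔n≤o⇒n≤o N₀ (N₁ ℕ.⊔ N₂) k≥)
        ≥₂ = λ {k} (k≥ : N₀ ℕ.⊔ (N₁ ℕ.⊔ N₂) ℕ.≤ k) → ℕₚ.m⊔n≤o⇒n≤o N₁ N₂ (ℕₚ.m⊔n≤o⇒n≤o N₀ (N₁ ℕ.⊔ N₂) k≥)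
        z≤ = λ m n m≥ n≥ → close {K} {h} {δ} m n N (near₁ m n (≥₁ m≥) (≥₁ n≥)) (<⇒≤ 0<h) P≤
               (w≤K n (≥₀ n≥)) Kh≡ (small n (≥₂ n≥))
    in N₀ ℕ.⊔ (N₁ ℕ.⊔ N₂) , λ m n m≥ n≥ → ≤⇒near (z≤ m n m≥ n≥) (z≤ n m n≥ m≥)

⊔-near : ∀ x y {δ} → ∣ x - y ∣ ≤ δ → ∣ (0ℚ ⊔ x) - (0ℚ ⊔ y) ∣ ≤ δ
⊔-near x y {δ} h =
  ≤⇒near {0ℚ ⊔ x} {0ℚ ⊔ y} (one x y h) (one y x (subst (_≤ δ) (∣-∣-sym x y) h))
  where
  one : ∀ x y → ∣ x - y ∣ ≤ δ → 0ℚ ⊔ x ≤ (0ℚ ⊔ y) + δ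
  one x y h = ⊔-lub {_} {0ℚ} {x}
    (+-nonneg {0ℚ ⊔ y} {δ} (p≤p⊔q 0ℚ y) (≤-trans (0≤∣p∣ (x - y)) h))
    (≤-trans (near⇒≤ {x} {y} h) (+-monoˡ-≤ δ (p≤q⊔p 0ℚ y)))

module _ {p : ℚ} (0<p : 0ℚ < p) where

  private
    instance
      p≢0 : NonZero p
      p≢0 = pos⇒nonZero p {{positive 0<p}}

    0≤p  = <⇒≤ 0<p
    0≤1/p : 0ℚ ≤ 1/ p
    0≤1/p = <⇒≤ (positive⁻¹ (1/ p) {{1/pos⇒pos p {{positive 0<p}}}})

    P : ℚ
    P = 1ℚ + (p + 1/ p)

    1≤P : 1ℚ ≤ P
    1≤P = ≤+ʳ (+-nonneg 0≤p 0≤1/p)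
    0≤P : 0ℚ ≤ P
    0≤P = ≤-trans 0≤1 1≤P
    p≤P : p ≤ P
    p≤P = ≤-trans (≤+ʳ 0≤1/p) (≤+ˡ 0≤1)
    1≤pP : 1ℚ ≤ p * P
    1≤pP = subst₂ _≤_ (*-inverseʳ p) (refl {x = p * P})
      (*-monoˡ-≤-nonNeg p {{nonNegative 0≤p}} (≤-trans (≤+ˡ 0≤p) (≤+ˡ 0≤1)))

    shift : ∀ m k e → m ℕ.≤ k ℕ.+ e → k ℕ.≤ m ℕ.+ e → p ^ m ≤ p ^ k * P ^ e
    shift m k e m≤ k≤ with ℕₚ.≤-total k m
    ... | inj₁ k≤m = subst (_≤ p ^ k * P ^ e)
          (trans (sym (^-homo-* p k (m ℕ.∸ k))) (^-congʳ p (ℕₚ.m+[n∸m]≡n k≤m)))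
          (*-monoˡ-≤-nonNeg (p ^ k) {{nonNegative (^-nonneg k 0≤p)}}
            (≤-trans (^-mono-≤ (m ℕ.∸ k) 0≤p p≤P) (P^-mono (ℕₚ.m≤n+o⇒m∸n≤o m k m≤))))
      where
      P^-mono : ∀ {i j} → i ℕ.≤ j → P ^ i ≤ P ^ j
      P^-mono {i} {j} i≤j = subst₂ _≤_ (*-identityʳ (P ^ i))
        (trans (sym (^-homo-* P i (j ℕ.∸ i))) (^-congʳ P (ℕₚ.m+[n∸m]≡n i≤j)))
        (*-monoˡ-≤-nonNeg (P ^ i) {{nonNegative (^-nonneg i 0≤P)}} (1≤^ (j ℕ.∸ i) 1≤P))
    ... | inj₂ m≤k = subst₂ _≤_ (*-identityʳ (p ^ m)) eq
          (*-monoˡ-≤-nonNeg (p ^ m) {{nonNegative (^-nonneg m 0≤p)}} 1≤)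
      where
      d = k ℕ.∸ m
      f = e ℕ.∸ d
      k≡ : m ℕ.+ d ≡ k
      k≡ = ℕₚ.m+[n∸m]≡n m≤k
      e≡ : d ℕ.+ f ≡ e
      e≡ = ℕₚ.m+[n∸m]≡n (ℕₚ.m≤n+o⇒m∸n≤o k m k≤)
      1≤ : 1ℚ ≤ (p * P) ^ d * P ^ f
      1≤ = subst (_≤ (p * P) ^ d * P ^ f) (*-identityˡ 1ℚ)
        (*-mono-≤ 0≤1 0≤1 (1≤^ d 1≤pP) (1≤^ f 1≤P))
      eq : p ^ m * ((p * P) ^ d * P ^ f) ≡ p ^ k * P ^ e
      eq = begin
        p ^ m * ((p * P) ^ d * P ^ f)     ≡⟨ cong (λ z → p ^ m * (z * P ^ f)) (^-distrib-* p P d) ⟩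
        p ^ m * (p ^ d * P ^ d * P ^ f)   ≡⟨ rearrange (p ^ m) (p ^ d) (P ^ d) (P ^ f) ⟩
        (p ^ m * p ^ d) * (P ^ d * P ^ f) ≡⟨ cong₂ _*_ (sym (^-homo-* p m d)) (sym (^-homo-* P d f)) ⟩
        p ^ (m ℕ.+ d) * P ^ (d ℕ.+ f)     ≡⟨ cong₂ (λ i j → p ^ i * P ^ j) k≡ e≡ ⟩
        p ^ k * P ^ e                     ∎
        where
        open ≡-Reasoning
        rearrange : ∀ a b c d → a * (b * c * d) ≡ (a * b) * (c * d)
        rearrange = solve 4 (λ a b c d → a :* (b :* c :* d) := (a :* b) :* (c :* d)) refl

    ^^ : ∀ x i j → (x ^ i) ^ j ≡ x ^ (i ℕ.* j)
    ^^ = ^-assocʳ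

    -- if x ≤ p^(i/d), p^(a/b) ≤ w, P^(1/N) ≤ C and ∣ a/b - i/d ∣ ≤ 1/N, then x ≤ w C
    compare : ∀ (i d a b N : ℕ) .{{_ : ℕ.NonZero d}} .{{_ : ℕ.NonZero b}} .{{_ : ℕ.NonZero N}} {x w C} →
      0ℚ ≤ x → 0ℚ ≤ w → 0ℚ ≤ C → x ^ d ≤ p ^ i → p ^ a ≤ w ^ b → P ≤ C ^ N →
      i ℕ.* b ℕ.* N ℕ.≤ a ℕ.* d ℕ.* N ℕ.+ d ℕ.* b →
      a ℕ.* d ℕ.* N ℕ.≤ i ℕ.* b ℕ.* N ℕ.+ d ℕ.* b →
      x ≤ w * C
    compare i d a b N {x} {w} {C} 0≤x 0≤w 0≤C x≤ ≤w ≤C h₁ h₂ =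
      ^-cancel-≤ (d ℕ.* b ℕ.* N) (*-nonneg 0≤w 0≤C) (begin
        x ^ (d ℕ.* b ℕ.* N)                       ≡⟨ sym (^^ x (d ℕ.* b) N) ⟩
        (x ^ (d ℕ.* b)) ^ N                       ≡⟨ cong (_^ N) (sym (^^ x d b)) ⟩
        ((x ^ d) ^ b) ^ N                         ≤⟨ ^-mono-≤ N (^-nonneg b (^-nonneg d 0≤x)) (^-mono-≤ b (^-nonneg d 0≤x) x≤) ⟩
        ((p ^ i) ^ b) ^ N                         ≡⟨ trans (cong (_^ N) (^^ p i b)) (^^ p (i ℕ.* b) N) ⟩
        p ^ (i ℕ.* b ℕ.* N)                       ≤⟨ shift (i ℕ.* b ℕ.* N) (a ℕ.* d ℕ.* N) (d ℕ.* b) h₁ h₂ ⟩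
        p ^ (a ℕ.* d ℕ.* N) * P ^ (d ℕ.* b)       ≤⟨ *-mono-≤ (^-nonneg (a ℕ.* d ℕ.* N) 0≤p) (^-nonneg (d ℕ.* b) 0≤P) left (^-mono-≤ (d ℕ.* b) 0≤P ≤C) ⟩
        w ^ (d ℕ.* b ℕ.* N) * (C ^ N) ^ (d ℕ.* b) ≡⟨ cong (w ^ (d ℕ.* b ℕ.* N) *_) (trans (^^ C N (d ℕ.* b)) (^-congʳ C (ℕₚ.*-comm N (d ℕ.* b)))) ⟩
        w ^ (d ℕ.* b ℕ.* N) * C ^ (d ℕ.* b ℕ.* N) ≡⟨ sym (^-distrib-* w C (d ℕ.* b ℕ.* N)) ⟩
        (w * C) ^ (d ℕ.* b ℕ.* N)                 ∎)
      where
      open ≤-Reasoning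
      instance
        db≢0 : ℕ.NonZero (d ℕ.* b)
        db≢0 = ℕₚ.m*n≢0 d b
        dbN≢0 : ℕ.NonZero (d ℕ.* b ℕ.* N)
        dbN≢0 = ℕₚ.m*n≢0 (d ℕ.* b) N
      left : p ^ (a ℕ.* d ℕ.* N) ≤ w ^ (d ℕ.* b ℕ.* N)
      left = begin
        p ^ (a ℕ.* d ℕ.* N)   ≡⟨ sym (trans (cong (_^ N) (^^ p a d)) (^^ p (a ℕ.* d) N)) ⟩
        ((p ^ a) ^ d) ^ N     ≤⟨ ^-mono-≤ N (^-nonneg d (^-nonneg a 0≤p)) (^-mono-≤ d (^-nonneg a 0≤p) ≤w) ⟩
        ((w ^ b) ^ d) ^ N     ≡⟨ trans (cong (_^ N) (^^ w b d)) (^^ w (b ℕ.* d) N) ⟩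
        w ^ (b ℕ.* d ℕ.* N)   ≡⟨ ^-congʳ w (cong (ℕ._* N) (ℕₚ.*-comm b d)) ⟩
        w ^ (d ℕ.* b ℕ.* N)   ∎

    clear : ∀ r s N → 0ℚ ≤ r → 0ℚ ≤ s → r ≤ s + + 1 / suc N →
      ℤ.∣ ↥ r ∣ ℕ.* ↧ₙ s ℕ.* suc N ℕ.≤ ℤ.∣ ↥ s ∣ ℕ.* ↧ₙ r ℕ.* suc N ℕ.+ ↧ₙ r ℕ.* ↧ₙ s
    clear r@(mkℚ (+ a) b-1 _) s@(mkℚ (+ c) d-1 _) N _ _ h = ℤₚ.drop‿+≤+ (subst₂ ℤ._≤_ e₁ e₂ (ℚᵘₚ.drop-*≤* h′))
      where
      open ℕSolver.+-*-Solver using () renaming (solve to solveℕ; _:=_ to _⩵_; _:+_ to _⊕_; _:*_ to _⊛_; con to κ)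
      b = suc b-1
      d = suc d-1
      M = suc N
      h′ : mkℚᵘ (+ a) b-1 ℚᵘ.≤ mkℚᵘ (+ c) d-1 ℚᵘ.+ mkℚᵘ (+ 1) N
      h′ = ℚᵘₚ.≤-respʳ-≃ (ℚᵘₚ.≃-trans (toℚᵘ-homo-+ s (+ 1 / M)) (ℚᵘₚ.+-cong (ℚᵘₚ.≃-refl {toℚᵘ s}) (toℚᵘ-/ 1 N))) (toℚᵘ-mono-≤ h)
      e₁ : + a ℤ.* + (d ℕ.* M) ≡ + (a ℕ.* d ℕ.* M)
      e₁ = trans (sym (ℤₚ.pos-* a (d ℕ.* M))) (cong +_ (sym (ℕₚ.*-assoc a d M)))
      e₂ : (+ c ℤ.* + M ℤ.+ + 1 ℤ.* + d) ℤ.* + b ≡ + (c ℕ.* b ℕ.* M ℕ.+ b ℕ.* d)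
      e₂ rewrite sym (ℤₚ.pos-* c M) | sym (ℤₚ.pos-* 1 d) | sym (ℤₚ.pos-* (c ℕ.* M ℕ.+ 1 ℕ.* d) b)
        = cong +_ (solveℕ 4 (λ c m d b → (c ⊛ m ⊕ κ 1 ⊛ d) ⊛ b ⩵ c ⊛ b ⊛ m ⊕ b ⊛ d) refl c M d b)
    clear (mkℚ ℤ.-[1+ a ] _ _) _ N 0≤r _ _ = contradiction (ℤₚ.≤-trans (drop-*≤* 0≤r) (ℤₚ.≤-refl)) λ { () }
    clear (mkℚ (+ a) _ _) (mkℚ ℤ.-[1+ _ ] _ _) N _ 0≤s _ = contradiction (drop-*≤* 0≤s) λ { () }

  powApprox-compare : ∀ m n {r s} N {C} → 0ℚ ≤ r → 0ℚ ≤ s → ∣ r - s ∣ ≤ + 1 / suc N →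
    0ℚ ≤ C → P ≤ C ^ suc N → powApprox m p r ≤ (powApprox n p s + + 1 / suc n) * C
  powApprox-compare m n {r} {s} N 0≤r 0≤s near 0≤C P≤C =
    compare ℤ.∣ ↥ r ∣ (↧ₙ r) ℤ.∣ ↥ s ∣ (↧ₙ s) (suc N)
      (rootApprox-nonneg m (↧ₙ r) (p ^ ℤ.∣ ↥ r ∣))
      (+-nonneg (rootApprox-nonneg n (↧ₙ s) (p ^ ℤ.∣ ↥ s ∣)) (0≤/ 1 n))
      0≤C
      (rootApprox-lower m (↧ₙ r) (p ^ ℤ.∣ ↥ r ∣) (^-nonneg ℤ.∣ ↥ r ∣ 0≤p))
      (<⇒≤ (rootApprox-upper n (↧ₙ s) (p ^ ℤ.∣ ↥ s ∣)))
      P≤C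
      (clear r s N 0≤r 0≤s (near⇒≤ near))
      (subst (ℤ.∣ ↥ s ∣ ℕ.* ↧ₙ r ℕ.* suc N ℕ.≤_)
        (cong (ℤ.∣ ↥ r ∣ ℕ.* ↧ₙ s ℕ.* suc N ℕ.+_) (ℕₚ.*-comm (↧ₙ s) (↧ₙ r)))
        (clear s r N 0≤s 0≤r (near⇒≤ (subst (_≤ _) (∣-∣-sym r s) near))))

  opaque
    powApprox-cauchy : ∀ y → IsCauchy (λ n → powApprox n p (0ℚ ⊔ seq y n))
    powApprox-cauchy y = SlowlyVarying.isCauchy (λ n → powApprox n p (0ℚ ⊔ seq y n)) y P 0≤P
      (λ n → rootApprox-nonneg n (↧ₙ (0ℚ ⊔ seq y n)) (p ^ ℤ.∣ ↥ (0ℚ ⊔ seq y n) ∣))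
      (λ m n N near → powApprox-compare m n {0ℚ ⊔ seq y m} {0ℚ ⊔ seq y n} N
        (p≤p⊔q 0ℚ (seq y m)) (p≤p⊔q 0ℚ (seq y n)) (⊔-near (seq y m) (seq y n) near))

infixr 8 _^ᴿ_

-- p ^ y for a rational base p ≥ 0 and a real exponent y ≥ 0: the limit of
-- p ^ yₙ, the n-th of these rounded down to a multiple of 1/(n+1).  Terms
-- yₙ < 0 are replaced by 0, which does not change the limit when y ≥ 0.
-- The convention 0 ^ 0 = 0 is built in.  Negative bases and exponents give
-- meaningless values.
_^ᴿ_ : ℚ → ℝ → ℝ
p ^ᴿ y with 0ℚ <? p
... | yes 0<p = mkℝ (λ n → powApprox n p (0ℚ ⊔ seq y n)) (powApprox-cauchy 0<p y)
... | no  _   = 0ᴿ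

ℝ-rawSemiring : RawSemiring 0ℓ 0ℓ
ℝ-rawSemiring = record
  { Carrier = ℝ ; _≈_ = _≈ᴿ_ ; _+_ = _+ᴿ_ ; _*_ = _*ᴿ_ ; 0# = 0ᴿ ; 1# = 1ᴿ }

record SimpleGraph (n : ℕ) : Set₁ where
  field
    Adj    : Binary.Rel (Fin n) 0ℓ
    adj?   : Binary.Decidable Adj
    symm   : Binary.Symmetric Adj
    irrefl : ∀ {v} → ¬ Adj v v

  neighbours : Fin n → List (Fin n)
  neighbours v = filter (adj? v) (allFin n)

  degree : Fin n → ℕ
  degree v = length (neighbours v)

  Connected : Set
  Connected = ∀ u v → Star Adj u v

  -- x = (x₀, …, xₜ)
  IsTrajectory : ∀ {t} → Fin n → Vec (Fin n) (suc t) → Set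
  IsTrajectory {t} u x =
    head x ≡ u × ∀ (i : Fin t) → Adj (lookup x (Fin.inject₁ i)) (lookup x (Fin.suc i))

-- A step rule gives the probability of moving to a given vertex at time i,
-- as a function of the history (X₀, …, Xᵢ); the current vertex is the last
-- entry of the history.
StepRule : Set → ℕ → Set
StepRule A n = (i : ℕ) → Vec (Fin n) (suc i) → Fin n → A

-- Probabilities are rational for the simple random walk and real for the
-- time-biased one.
module Process (R : RawSemiring 0ℓ 0ℓ) {n : ℕ} where
  open RawSemiring R using (Carrier; 0#; 1#) renaming (_*_ to _·_)
  open RawSemiringDefs R using (sum)

  sumVec : ∀ m → (Vec (Fin n) m → Carrier) → Carrier
  sumVec zero    f = f []
  sumVec (suc m) f = sum λ v → sumVec m λ x → f (v ∷ x)

  -- the probability that (X₀, …, Xₜ) = x when X₀ = u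
  pathProb : StepRule Carrier n → Fin n → ∀ t → Vec (Fin n) (suc t) → Carrier
  pathProb step u zero    x = if does (head x Finₚ.≟ u) then 1# else 0#
  pathProb step u (suc t) x = pathProb step u t (init x) · step t (init x) (last x)

  prob : StepRule Carrier n → Fin n → ∀ t {S : Pred (Vec (Fin n) (suc t)) 0ℓ} → Decidable S → Carrier
  prob step u t S? = sumVec (suc t) λ x → if does (S? x) then pathProb step u t x else 0#

reciprocal : ℕ → ℚ
reciprocal zero    = 0ℚ
reciprocal (suc d) = + 1 / suc d

module _ {n : ℕ} (G : SimpleGraph n) where
  open SimpleGraph G
  open RawSemiringDefs ℝ-rawSemiring using (sum)

  srwStep : StepRule ℚ n
  srwStep i h v = if does (adj? (last h) v) then reciprocal (degree (last h)) else 0ℚ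

  -- The weights must sum to 1 as soon as the current vertex has a neighbour.
  -- On the one-vertex graph no move is possible, and this keeps the set of
  -- strategies nonempty there.
  record Strategy : Set where
    field
      weight  : StepRule ℝ n
      nonneg  : ∀ i h v → 0ᴿ ≤ᴿ weight i h v
      support : ∀ i h v → ¬ Adj (last h) v → weight i h v ≈ᴿ 0ᴿ
      total   : ∀ i h v → Adj (last h) v → sum (weight i h) ≈ᴿ 1ᴿ

  tbrwStep : ℝ → Strategy → StepRule ℝ n
  tbrwStep ε σ i h v =
    (1ᴿ -ᴿ ε) *ᴿ fromℚ (srwStep i h v) +ᴿ ε *ᴿ Strategy.weight σ i h v

  srwProb : Fin n → ∀ t {S : Pred (Vec (Fin n) (suc t)) 0ℓ} → Decidable S → ℚ
  srwProb = Process.prob +-*-rawSemiring srwStep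

  tbrwProb : ℝ → Strategy → Fin n → ∀ t {S : Pred (Vec (Fin n) (suc t)) 0ℓ} → Decidable S → ℝ
  tbrwProb ε σ = Process.prob ℝ-rawSemiring (tbrwStep ε σ)

{-# OPTIONS --safe #-}

-- The strategy moves to a neighbour that maximises the probability p that the
-- simple random walk, continued from there, ends in S.  These probabilities
-- are rational, so the maximum is attained decidably, and the choice does not
-- depend on ε.  The bound q ≥ p^(1-ε) is propagated backwards in time: if a is
-- the average and M the maximum of the values p_v at the neighbours, then
-- p_v^(1-ε) ≥ p_v M^(-ε), so by weighted AM-GM
--   (1-ε) avg p_v^(1-ε) + ε M^(1-ε) ≥ M^(-ε) ((1-ε) a + ε M) ≥ a^(1-ε).
-- For rational ε this is done without roots, by comparing q with every
-- rational z such that z^(k+l) ≤ p^k, where 1-ε = k/(k+l).  A real ε is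
-- handled along the sequence representing it, since the arithmetic of ℝ is
-- termwise.
module Submission where

open import Algebra.Bundles using (CommutativeRing)
import Algebra.Definitions.RawSemiring as RawSemiringDefs
import Algebra.Properties.CommutativeSemiring.Exp as Exp
import Algebra.Properties.Semiring.Sum as Sum
open import Data.Bool.Base using (if_then_else_; true; false)
open import Data.Fin.Base using (Fin; zero; suc)
import Data.Fin.Properties as Finₚ
import Data.Integer.Base as ℤ
open import Data.List.Base using (length; filter; tabulate)
open import Data.Maybe.Base using (Maybe; just; nothing; maybe′)
open import Data.Nat.Base as ℕ using (ℕ; zero; suc)
import Data.Nat.Properties as ℕₚ
open import Data.Product using (Σ-syntax; ∃-syntax; _×_; _,_; proj₁; proj₂)
open import Data.Rational.Base hiding (_≃_)
open import Data.Rational.Properties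
open import Data.Rational.Solver using (module +-*-Solver)
open import Data.Sum.Base using (inj₁; inj₂)
open import Data.Vec.Base using (Vec; []; _∷_; _∷ʳ_; last; init; head)
open import Data.Vec.Properties using (init-∷ʳ; last-∷ʳ)
open import Function.Base using (_∘_)
open import Level using (0ℓ)
open import Relation.Binary.PropositionalEquality
open import Relation.Nullary using (yes; no; does; ¬_; contradiction)
open import Relation.Unary using (Pred; Decidable)
open import Defs

open RawSemiringDefs +-*-rawSemiring using (_^_)
open RawSemiringDefs ℝ-rawSemiring using () renaming (sum to sumᴿ)
open Exp (CommutativeRing.commutativeSemiring +-*-commutativeRing)
  using (^-homo-*; ^-distrib-*)
open Sum (CommutativeRing.semiring +-*-commutativeRing)
  using (sum; sum-cong-≗; ∑-distrib-+; *-distribˡ-sum; *-distribʳ-sum; sum-replicate-zero)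
open +-*-Solver using (solve; _:=_; _:+_; _:*_; _:-_; :-_; con)

-- Naturals and order in the rationals

fromℕ-suc : ∀ n → fromℕ (suc n) ≡ fromℕ n + 1ℚ
fromℕ-suc n = /-suc n 0

fromℕ-+ : ∀ m n → fromℕ (m ℕ.+ n) ≡ fromℕ m + fromℕ n
fromℕ-+ zero    n = sym (+-identityˡ (fromℕ n))
fromℕ-+ (suc m) n = begin
  fromℕ (suc (m ℕ.+ n))      ≡⟨ fromℕ-suc (m ℕ.+ n) ⟩
  fromℕ (m ℕ.+ n) + 1ℚ       ≡⟨ cong (_+ 1ℚ) (fromℕ-+ m n) ⟩
  fromℕ m + fromℕ n + 1ℚ     ≡⟨ solve 2 (λ m n → m :+ n :+ con 1ℚ := m :+ con 1ℚ :+ n) refl (fromℕ m) (fromℕ n) ⟩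
  fromℕ m + 1ℚ + fromℕ n     ≡⟨ cong (_+ fromℕ n) (sym (fromℕ-suc m)) ⟩
  fromℕ (suc m) + fromℕ n    ∎
  where open ≡-Reasoning

0<fromℕ : ∀ n .{{_ : ℕ.NonZero n}} → 0ℚ < fromℕ n
0<fromℕ (suc n) = positive⁻¹ (fromℕ (suc n)) {{normalize-pos (suc n) 1}}

p≤q⇒0≤q-p : ∀ {p q} → p ≤ q → 0ℚ ≤ q - p
p≤q⇒0≤q-p {p} {q} p≤q = subst (_≤ q - p) (+-inverseʳ p) (+-monoˡ-≤ (- p) p≤q)

+-cancelˡ-≤ : ∀ r {p q} → r + p ≤ r + q → p ≤ q
+-cancelˡ-≤ r {p} {q} h = subst₂ _≤_ (cancel r p) (cancel r q) (+-monoʳ-≤ (- r) h)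
  where
  cancel : ∀ r p → - r + (r + p) ≡ p
  cancel = solve 2 (λ r p → :- r :+ (r :+ p) := p) refl

square-nonneg : ∀ p → 0ℚ ≤ p * p
square-nonneg p with ≤-total 0ℚ p
... | inj₁ 0≤p = *-nonneg 0≤p 0≤p
... | inj₂ p≤0 = subst (0ℚ ≤_) (solve 1 (λ p → :- p :* :- p := p :* p) refl p)
  (*-nonneg (neg-antimono-≤ p≤0) (neg-antimono-≤ p≤0))

-- Weighted AM-GM inequality with denominators cleared

-- Convexity of x ↦ xⁿ⁺¹: its graph lies above the tangent at c.
tangent : ∀ n {x c} → 0ℚ ≤ x → 0ℚ ≤ c →
  fromℕ (suc n) * x * c ^ n ≤ x ^ suc n + fromℕ n * c ^ suc n
tangent zero {x} {c} 0≤x 0≤c = ≤-reflexive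
  (solve 2 (λ x c → con 1ℚ :* x :* con 1ℚ := x :* con 1ℚ :+ con 0ℚ :* (c :* con 1ℚ)) refl x c)
tangent (suc n) {x} {c} 0≤x 0≤c = subst (fromℕ (suc (suc n)) * x * c ^ suc n ≤_) eq
  -- The gap between the two sides is x times the gap of the previous case plus (n + 1) c^n (x -
  -- c)^2.
  (≤+ʳ (+-nonneg
    (*-nonneg 0≤x (p≤q⇒0≤q-p (tangent n 0≤x 0≤c)))
    (*-nonneg (*-nonneg (0≤/ (suc n) 0) (^-nonneg n 0≤c)) (square-nonneg (x - c)))))
  where
  eq : fromℕ (suc (suc n)) * x * c ^ suc n
       + (x * (x ^ suc n + fromℕ n * c ^ suc n - fromℕ (suc n) * x * c ^ n)
          + fromℕ (suc n) * c ^ n * ((x - c) * (x - c)))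
     ≡ x ^ suc (suc n) + fromℕ (suc n) * c ^ suc (suc n)
  eq rewrite fromℕ-suc (suc n) | fromℕ-suc n =
    solve 5 (λ N x c X P →
      (N :+ con 1ℚ :+ con 1ℚ) :* x :* (c :* P)
        :+ (x :* (X :+ N :* (c :* P) :- (N :+ con 1ℚ) :* x :* P)
            :+ (N :+ con 1ℚ) :* P :* ((x :- c) :* (x :- c)))
      := x :* X :+ (N :+ con 1ℚ) :* (c :* (c :* P)))
      refl (fromℕ n) x c (x ^ suc n) (c ^ n)

-- Up to denominators, y (s/n)^n ≤ ((s + y)/(n + 1))^(n + 1): the effect on AM-GM of adding one
-- number y to n numbers with sum s. For n > 0 it is `tangent` at x = n (s + y) and c = (n + 1) s,
-- after cancelling n c^(n + 1) and a factor n.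
amgm-step : ∀ n {s y} → 0ℚ ≤ s → 0ℚ ≤ y →
  y * s ^ n * fromℕ (suc n) ^ suc n ≤ (s + y) ^ suc n * fromℕ n ^ n
amgm-step zero {s} {y} 0≤s 0≤y = subst₂ _≤_
  (solve 1 (λ y → y := y :* con 1ℚ :* (con 1ℚ :* con 1ℚ)) refl y)
  (solve 2 (λ s y → s :+ y := (s :+ y) :* con 1ℚ :* con 1ℚ) refl s y)
  (≤+ˡ 0≤s)
amgm-step n@(suc _) {s} {y} 0≤s 0≤y =
  *-cancelˡ-≤-pos N {{positive (0<fromℕ n)}} (+-cancelˡ-≤ (N * C ^ suc n) (begin
    N * (C * C ^ n) + N * (y * s ^ n * (M * M ^ n))
      ≡⟨ solve 7 (λ N M s y S T P →
           N :* (M :* s :* P) :+ N :* (y :* S :* (M :* T)) := N :* (M :* s :* P) :+ N :* M :* y :* (T :* S))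
           refl N M s y (s ^ n) (M ^ n) (C ^ n) ⟩
    N * (M * s * C ^ n) + N * M * y * (M ^ n * s ^ n)
      ≡⟨ cong (λ z → N * (M * s * C ^ n) + N * M * y * z) (sym (^-distrib-* M s n)) ⟩
    N * (M * s * C ^ n) + N * M * y * C ^ n
      ≡⟨ solve 5 (λ N M s y P → N :* (M :* s :* P) :+ N :* M :* y :* P := M :* (N :* (s :+ y)) :* P)
           refl N M s y (C ^ n) ⟩
    M * X * C ^ n
      ≤⟨ tangent n (*-nonneg (0≤/ n 0) (+-nonneg 0≤s 0≤y)) (*-nonneg (0≤/ (suc n) 0) 0≤s) ⟩
    X ^ suc n + N * C ^ suc n
      ≡⟨ +-comm (X ^ suc n) (N * C ^ suc n) ⟩
    N * C ^ suc n + X ^ suc n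
      ≡⟨ cong (N * C ^ suc n +_) (trans (^-distrib-* N (s + y) (suc n))
           (solve 3 (λ N P Q → N :* P :* Q := N :* (Q :* P)) refl N (N ^ n) ((s + y) ^ suc n))) ⟩
    N * C ^ suc n + N * ((s + y) ^ suc n * N ^ n) ∎))
  where
  open ≤-Reasoning
  N = fromℕ n
  M = fromℕ (suc n)
  C = M * s
  X = N * (s + y)

-- AM-GM for l copies of y and k copies of x. Without any y it is an equality, and `amgm-step` adds
-- the copies of y one at a time.
amgm : ∀ l k {x y} → 0ℚ ≤ x → 0ℚ ≤ y →
  y ^ l * x ^ k * fromℕ (l ℕ.+ k) ^ (l ℕ.+ k) ≤ (fromℕ l * y + fromℕ k * x) ^ (l ℕ.+ k)
amgm zero k {x} {y} 0≤x 0≤y = ≤-reflexive (begin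
  1ℚ * x ^ k * fromℕ k ^ k      ≡⟨ solve 2 (λ a b → con 1ℚ :* a :* b := b :* a) refl (x ^ k) (fromℕ k ^ k) ⟩
  fromℕ k ^ k * x ^ k           ≡⟨ sym (^-distrib-* (fromℕ k) x k) ⟩
  (fromℕ k * x) ^ k             ≡⟨ cong (_^ k) (solve 2 (λ y z → z := con 0ℚ :* y :+ z) refl y (fromℕ k * x)) ⟩
  (0ℚ * y + fromℕ k * x) ^ k    ∎)
  where open ≡-Reasoning
amgm (suc l) k {x} {y} 0≤x 0≤y = *-cancelʳ-≤-pos (N ^ n) {{positive 0<Nⁿ}} (begin
  y ^ suc l * x ^ k * M ^ suc n * N ^ n
    ≡⟨ solve 5 (λ y a b m n → y :* a :* b :* m :* n := (y :* m) :* (a :* b :* n)) refl y (y ^ l) (x ^ k) (M ^ suc n) (N ^ n) ⟩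
  y * M ^ suc n * (y ^ l * x ^ k * N ^ n)
    ≤⟨ *-monoˡ-≤-nonNeg (y * M ^ suc n) {{nonNegative (*-nonneg 0≤y (^-nonneg (suc n) (0≤/ (suc n) 0)))}} (amgm l k 0≤x 0≤y) ⟩
  y * M ^ suc n * s ^ n
    ≡⟨ *-swapʳ y (M ^ suc n) (s ^ n) ⟩
  y * s ^ n * M ^ suc n
    ≤⟨ amgm-step n (+-nonneg (*-nonneg (0≤/ l 0) 0≤y) (*-nonneg (0≤/ k 0) 0≤x)) 0≤y ⟩
  (s + y) ^ suc n * N ^ n
    ≡⟨ cong (λ z → z ^ suc n * N ^ n) s+y≡ ⟩
  (fromℕ (suc l) * y + fromℕ k * x) ^ suc n * N ^ n ∎)
  where
  open ≤-Reasoning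
  n = l ℕ.+ k
  N = fromℕ n
  M = fromℕ (suc n)
  s = fromℕ l * y + fromℕ k * x
  s+y≡ : s + y ≡ fromℕ (suc l) * y + fromℕ k * x
  s+y≡ rewrite fromℕ-suc l = solve 4 (λ l y k x → l :* y :+ k :* x :+ y := (l :+ con 1ℚ) :* y :+ k :* x) refl (fromℕ l) y (fromℕ k) x
  0<Nⁿ : 0ℚ < N ^ n
  -- For n = 0 the base N is 0, but `_^_` has 0 ^ 0 = 1.
  0<Nⁿ with n
  ... | zero  = 0<1
  ... | suc m = ^-pos (suc m) (0<fromℕ (suc m))

-- The equation for e encodes e = l/(k + l) without division; multiplying by (k + l)^(k + l) turns
-- the claim into `amgm`.
weighted-amgm : ∀ k l .{{_ : ℕ.NonZero (k ℕ.+ l)}} {e x y} → fromℕ (k ℕ.+ l) * e ≡ fromℕ l →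
  0ℚ ≤ x → 0ℚ ≤ y → x ^ k * y ^ l ≤ ((1ℚ - e) * x + e * y) ^ (k ℕ.+ l)
weighted-amgm k l {e} {x} {y} be≡l 0≤x 0≤y =
  *-cancelʳ-≤-pos (B ^ b) {{positive (^-pos b (0<fromℕ b))}} (begin
    x ^ k * y ^ l * B ^ b                   ≡⟨ cong (_* B ^ b) (*-comm (x ^ k) (y ^ l)) ⟩
    y ^ l * x ^ k * B ^ b                   ≡⟨ cong (λ z → y ^ l * x ^ k * fromℕ z ^ z) (ℕₚ.+-comm k l) ⟩
    y ^ l * x ^ k * fromℕ (l ℕ.+ k) ^ (l ℕ.+ k) ≤⟨ amgm l k 0≤x 0≤y ⟩
    (L * y + K * x) ^ (l ℕ.+ k)             ≡⟨ cong₂ _^_ mean (ℕₚ.+-comm l k) ⟩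
    (m * B) ^ b                             ≡⟨ ^-distrib-* m B b ⟩
    m ^ b * B ^ b                           ∎)
  where
  open ≤-Reasoning
  b = k ℕ.+ l
  B = fromℕ b
  K = fromℕ k
  L = fromℕ l
  m = (1ℚ - e) * x + e * y
  mean : L * y + K * x ≡ m * B
  mean = trans
    (cong (λ z → L * y + z * x) (trans (solve 2 (λ k l → k := k :+ l :- l) refl K L)
      (cong₂ _-_ (sym (fromℕ-+ k l)) (sym be≡l))))
    (trans (cong (λ z → z * y + (B - B * e) * x) (sym be≡l))
      (solve 4 (λ b e x y → b :* e :* y :+ (b :- b :* e) :* x := ((con 1ℚ :- e) :* x :+ e :* y) :* b) refl B e x y))

-- Finite sums, point masses and maximisers

sum-mono-≤ : ∀ {n} {f g : Fin n → ℚ} → (∀ i → f i ≤ g i) → sum f ≤ sum g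
sum-mono-≤ {zero}  f≤g = ≤-refl
sum-mono-≤ {suc n} f≤g = +-mono-≤ (f≤g zero) (sum-mono-≤ (f≤g ∘ suc))

sum-zero : ∀ {n} {f : Fin n → ℚ} → (∀ i → f i ≡ 0ℚ) → sum f ≡ 0ℚ
sum-zero {n} f≡0 = trans (sum-cong-≗ f≡0) (sum-replicate-zero n)

sum-nonneg : ∀ {n} {f : Fin n → ℚ} → (∀ i → 0ℚ ≤ f i) → 0ℚ ≤ sum f
sum-nonneg {n} {f} 0≤f = subst (_≤ sum f) (sum-replicate-zero n) (sum-mono-≤ 0≤f)

-- The general g is for the induction, which passes to `g ∘ suc`; with g the identity, the list is
-- that of the neighbours.
sum-if : ∀ {m n} {P : Pred (Fin n) 0ℓ} (P? : Decidable P) (g : Fin m → Fin n) r →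
  sum (λ i → if does (P? (g i)) then r else 0ℚ) ≡ fromℕ (length (filter P? (tabulate g))) * r
sum-if {zero}  P? g r = sym (*-zeroˡ r)
sum-if {suc m} P? g r with does (P? (g zero)) | sum-if P? (g ∘ suc) r
... | false | ih = trans (+-identityˡ _) ih
... | true  | ih = begin
  r + sum (λ i → if does (P? (g (suc i))) then r else 0ℚ)  ≡⟨ cong (r +_) ih ⟩
  r + N * r                                                ≡⟨ solve 2 (λ r N → r :+ N :* r := (N :+ con 1ℚ) :* r) refl r N ⟩
  (N + 1ℚ) * r                                             ≡⟨ cong (_* r) (sym (fromℕ-suc k)) ⟩
  fromℕ (suc k) * r                                        ∎
  where
  open ≡-Reasoning
  k = length (filter P? (tabulate (g ∘ suc)))
  N = fromℕ k

pointMass : ∀ {n} → Fin n → Fin n → ℚ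
pointMass c v = if does (v Finₚ.≟ c) then 1ℚ else 0ℚ

sum-pointMass-* : ∀ {n} c (f : Fin n → ℚ) → sum (λ v → pointMass c v * f v) ≡ f c
sum-pointMass-* zero f = trans
  (cong₂ _+_ (*-identityˡ (f zero)) (sum-zero (λ i → *-zeroˡ (f (suc i)))))
  (+-identityʳ (f zero))
sum-pointMass-* (suc c) f = trans
  (cong₂ _+_ (*-zeroˡ (f zero)) (sum-pointMass-* c (f ∘ suc)))
  (+-identityˡ (f (suc c)))

-- `nothing` stands for the absence of a neighbour to move to; the total mass is then 0.
mass : ∀ {n} → Maybe (Fin n) → Fin n → ℚ
mass = maybe′ pointMass (λ _ → 0ℚ)

mass-nonneg : ∀ {n} (m : Maybe (Fin n)) v → 0ℚ ≤ mass m v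
mass-nonneg nothing  v = ≤-refl
mass-nonneg (just c) v with does (v Finₚ.≟ c)
... | false = ≤-refl
... | true  = 0≤1

IsMaximiser : ∀ {n} → Pred (Fin n) 0ℓ → (Fin n → ℚ) → Maybe (Fin n) → Set
IsMaximiser P f nothing  = ∀ v → ¬ P v
IsMaximiser P f (just c) = P c × ∀ v → P v → f v ≤ f c

maximiser : ∀ {n} {P : Pred (Fin n) 0ℓ} → Decidable P → (f : Fin n → ℚ) → ∃[ m ] IsMaximiser P f m
maximiser {zero}  P? f = nothing , λ ()
maximiser {suc n} {P} P? f with P? zero | maximiser (P? ∘ suc) (f ∘ suc)
... | no ¬P0 | nothing , none    = nothing , λ { zero → ¬P0 ; (suc v) → none v }
... | yes P0 | nothing , none    = just zero , P0 ,
      λ { zero _ → ≤-refl ; (suc v) Pv → contradiction Pv (none v) }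
... | no ¬P0 | just c , Pc , max = just (suc c) , Pc ,
      λ { zero P0 → contradiction P0 ¬P0 ; (suc v) → max v }
... | yes P0 | just c , Pc , max with ≤-total (f zero) (f (suc c))
...   | inj₁ f0≤fc = just (suc c) , Pc , λ { zero _ → f0≤fc ; (suc v) → max v }
...   | inj₂ fc≤f0 = just zero , P0 , λ { zero _ → ≤-refl ; (suc v) Pv → ≤-trans (max v Pv) fc≤f0 }

-- Comparison with powers without roots, and one step back in time

-- For 0 < p ≤ 1 the last field says q ≥ p ^ (k/(k+l)), a number that is
-- in general irrational; nothing is required of the power when p = 0.
record Dominates (k l : ℕ) (p q : ℚ) : Set where
  field
    0≤p   : 0ℚ ≤ p
    p≤1   : p ≤ 1ℚ
    0≤q   : 0ℚ ≤ q
    bound : 0ℚ < p → ∀ {z} → 0ℚ ≤ z → z ^ (k ℕ.+ l) ≤ p ^ k → z ≤ q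

1^ : ∀ n → 1ℚ ^ n ≡ 1ℚ
1^ zero    = refl
1^ (suc n) = trans (*-identityˡ (1ℚ ^ n)) (1^ n)

dominates-0 : ∀ k l → Dominates k l 0ℚ 0ℚ
dominates-0 k l = record
  { 0≤p = ≤-refl ; p≤1 = 0≤1 ; 0≤q = ≤-refl
  ; bound = λ 0<0 → contradiction 0<0 (<-irrefl refl) }

dominates-1 : ∀ k l .{{_ : ℕ.NonZero (k ℕ.+ l)}} → Dominates k l 1ℚ 1ℚ
dominates-1 k l = record
  { 0≤p = 0≤1 ; p≤1 = ≤-refl ; 0≤q = 0≤1
  ; bound = λ _ {z} _ h → ^-cancel-≤ (k ℕ.+ l) 0≤1
      (subst (z ^ (k ℕ.+ l) ≤_) (trans (1^ k) (sym (1^ (k ℕ.+ l)))) h) }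

≤-mean : ∀ {e a M} → 0ℚ ≤ e → a ≤ M → a ≤ (1ℚ - e) * a + e * M
≤-mean {e} {a} {M} 0≤e a≤M = subst (a ≤_)
  (solve 3 (λ e a M → a :+ e :* (M :- a) := (con 1ℚ :- e) :* a :+ e :* M) refl e a M)
  (≤+ʳ (*-nonneg 0≤e (p≤q⇒0≤q-p a≤M)))

-- A form of η ≤ M^(-l/(k + l)) free of roots and division. Multiplied by m^(k + l), the left side
-- becomes z^(k + l) M^l, and the two hypotheses chain.
scale-bound : ∀ k l {a M m z η} → 0ℚ ≤ M → 0ℚ < m → m * η ≡ z → z ^ (k ℕ.+ l) ≤ a ^ k →
  a ^ k * M ^ l ≤ m ^ (k ℕ.+ l) → η ^ (k ℕ.+ l) * M ^ l ≤ 1ℚ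
scale-bound k l {a} {M} {m} {z} {η} 0≤M 0<m mη≡z zᵇ≤aᵏ aᵏMˡ≤mᵇ =
  *-cancelˡ-≤-pos (m ^ b) {{positive (^-pos b 0<m)}} (begin
    m ^ b * (η ^ b * M ^ l)   ≡⟨ sym (*-assoc (m ^ b) (η ^ b) (M ^ l)) ⟩
    m ^ b * η ^ b * M ^ l     ≡⟨ cong (_* M ^ l) (sym (^-distrib-* m η b)) ⟩
    (m * η) ^ b * M ^ l       ≡⟨ cong (λ x → x ^ b * M ^ l) mη≡z ⟩
    z ^ b * M ^ l             ≤⟨ *-monoʳ-≤-nonNeg (M ^ l) {{nonNegative (^-nonneg l 0≤M)}} zᵇ≤aᵏ ⟩
    a ^ k * M ^ l             ≤⟨ aᵏMˡ≤mᵇ ⟩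
    m ^ b                     ≡⟨ sym (*-identityʳ (m ^ b)) ⟩
    m ^ b * 1ℚ                ∎)
  where
  open ≤-Reasoning
  b = k ℕ.+ l

-- For p > 0, (η p)^(k + l) = p^k η^(k + l) p^l ≤ p^k because p ≤ M, so η p is an admissible z in
-- `bound`. For p = 0 nonnegativity of q suffices.
scaled-≤ : ∀ k l {p q M η} → Dominates k l p q → 0ℚ ≤ η → p ≤ M →
  η ^ (k ℕ.+ l) * M ^ l ≤ 1ℚ → η * p ≤ q
scaled-≤ k l {p} {q} {M} {η} p≼q 0≤η p≤M ηᵇMˡ≤1 with 0ℚ <? p
... | no 0≮p = subst (_≤ q)
      (sym (trans (cong (η *_) (≤-antisym (≮⇒≥ 0≮p) 0≤p)) (*-zeroʳ η))) 0≤q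
  where open Dominates p≼q
... | yes 0<p = bound 0<p (*-nonneg 0≤η 0≤p) (begin
  (η * p) ^ b               ≡⟨ ^-distrib-* η p b ⟩
  η ^ b * p ^ b             ≡⟨ cong (η ^ b *_) (^-homo-* p k l) ⟩
  η ^ b * (p ^ k * p ^ l)   ≡⟨ swap (η ^ b) (p ^ k) (p ^ l) ⟩
  p ^ k * (η ^ b * p ^ l)   ≤⟨ *-monoˡ-≤-nonNeg (p ^ k) {{nonNegative (^-nonneg k 0≤p)}}
                                 (≤-trans (*-monoˡ-≤-nonNeg (η ^ b) {{nonNegative (^-nonneg b 0≤η)}}
                                   (^-mono-≤ l 0≤p p≤M)) ηᵇMˡ≤1) ⟩
  p ^ k * 1ℚ                ≡⟨ *-identityʳ (p ^ k) ⟩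
  p ^ k                     ∎)
  where
  open ≤-Reasoning
  open Dominates p≼q
  b = k ℕ.+ l
  swap : ∀ x y w → x * (y * w) ≡ y * (x * w)
  swap = solve 3 (λ x y w → x :* (y :* w) := y :* (x :* w)) refl

-- In the application P is adjacency to the current vertex, s the simple random walk step, and F and
-- H are the values at the next vertex for the simple and the biased walk. The sum of s is only
-- bounded by 1, since it is 0 at a vertex without neighbours.
module BiasedAverage
  (k l : ℕ) .{{_ : ℕ.NonZero (k ℕ.+ l)}} {e : ℚ}
  (be≡l : fromℕ (k ℕ.+ l) * e ≡ fromℕ l) (0≤e : 0ℚ ≤ e) (e≤1 : e ≤ 1ℚ)
  {n} {P : Pred (Fin n) 0ℓ} (s : Fin n → ℚ)
  (0≤s : ∀ v → 0ℚ ≤ s v) (s≡0 : ∀ v → ¬ P v → s v ≡ 0ℚ) (P? : Decidable P)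
  (Σs≤1 : sum s ≤ 1ℚ)
  {F H : Fin n → ℚ} (F≼H : ∀ v → Dominates k l (F v) (H v))
  where

  open module D v = Dominates (F≼H v)

  b : ℕ
  b = k ℕ.+ l

  0≤1-e : 0ℚ ≤ 1ℚ - e
  0≤1-e = p≤q⇒0≤q-p e≤1

  a : ℚ
  a = sum λ v → s v * F v

  biased : Maybe (Fin n) → ℚ
  biased m = sum λ v → ((1ℚ - e) * s v + e * mass m v) * H v

  0≤a : 0ℚ ≤ a
  0≤a = sum-nonneg λ v → *-nonneg (0≤s v) (0≤p v)

  a≤ : ∀ {M} → 0ℚ ≤ M → (∀ v → P v → F v ≤ M) → a ≤ M
  a≤ {M} 0≤M F≤M = begin
    a                     ≤⟨ sum-mono-≤ term ⟩
    sum (λ v → s v * M)   ≡⟨ sym (*-distribʳ-sum M s) ⟩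
    sum s * M             ≤⟨ *-monoʳ-≤-nonNeg M {{nonNegative 0≤M}} Σs≤1 ⟩
    1ℚ * M                ≡⟨ *-identityˡ M ⟩
    M                     ∎
    where
    open ≤-Reasoning
    term : ∀ v → s v * F v ≤ s v * M
    term v with P? v
    ... | yes Pv = *-monoˡ-≤-nonNeg (s v) {{nonNegative (0≤s v)}} (F≤M v Pv)
    ... | no ¬Pv = ≤-reflexive (trans (trans (cong (_* F v) (s≡0 v ¬Pv)) (*-zeroˡ (F v)))
                     (sym (trans (cong (_* M) (s≡0 v ¬Pv)) (*-zeroˡ M))))

  0≤biased : ∀ m → 0ℚ ≤ biased m
  0≤biased m = sum-nonneg λ v →
    *-nonneg (+-nonneg (*-nonneg 0≤1-e (0≤s v)) (*-nonneg 0≤e (mass-nonneg m v))) (0≤q v)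

  biased-just : ∀ c → biased (just c) ≡ (1ℚ - e) * sum (λ v → s v * H v) + e * H c
  biased-just c = begin
    sum (λ v → ((1ℚ - e) * s v + e * δ v) * H v)
      ≡⟨ sum-cong-≗ (λ v → distrib (1ℚ - e) e (s v) (δ v) (H v)) ⟩
    sum (λ v → (1ℚ - e) * (s v * H v) + e * (δ v * H v))
      ≡⟨ ∑-distrib-+ (λ v → (1ℚ - e) * (s v * H v)) (λ v → e * (δ v * H v)) ⟩
    sum (λ v → (1ℚ - e) * (s v * H v)) + sum (λ v → e * (δ v * H v))
      ≡⟨ sym (cong₂ _+_ (*-distribˡ-sum (1ℚ - e) (λ v → s v * H v)) (*-distribˡ-sum e (λ v → δ v * H v))) ⟩
    (1ℚ - e) * sum (λ v → s v * H v) + e * sum (λ v → δ v * H v)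
      ≡⟨ cong (λ z → (1ℚ - e) * sum (λ v → s v * H v) + e * z) (sum-pointMass-* c H) ⟩
    (1ℚ - e) * sum (λ v → s v * H v) + e * H c ∎
    where
    open ≡-Reasoning
    δ = pointMass c
    distrib : ∀ d e s w h → (d * s + e * w) * h ≡ d * (s * h) + e * (w * h)
    distrib = solve 5 (λ d e s w h → (d :* s :+ e :* w) :* h := d :* (s :* h) :+ e :* (w :* h)) refl

  -- The factor η comes out of both the average and the controlled move. Averaging the pointwise
  -- bound over P is enough, as s vanishes elsewhere.
  biased-lower : ∀ c → P c → ∀ {η} → (∀ v → P v → η * F v ≤ H v) →
    ((1ℚ - e) * a + e * F c) * η ≤ biased (just c)
  biased-lower c Pc {η} ηF≤H = begin
    ((1ℚ - e) * a + e * F c) * η                     ≡⟨ distrib (1ℚ - e) e a (F c) η ⟩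
    (1ℚ - e) * (η * a) + e * (η * F c)               ≤⟨ +-mono-≤ (*-monoˡ-≤-nonNeg (1ℚ - e) {{nonNegative 0≤1-e}} average)
                                                          (*-monoˡ-≤-nonNeg e {{nonNegative 0≤e}} (ηF≤H c Pc)) ⟩
    (1ℚ - e) * sum (λ v → s v * H v) + e * H c       ≡⟨ sym (biased-just c) ⟩
    biased (just c)                                  ∎
    where
    open ≤-Reasoning
    distrib : ∀ d e a M η → (d * a + e * M) * η ≡ d * (η * a) + e * (η * M)
    distrib = solve 5 (λ d e a M η → (d :* a :+ e :* M) :* η := d :* (η :* a) :+ e :* (η :* M)) refl
    swap : ∀ η s f → η * (s * f) ≡ s * (η * f)
    swap = solve 3 (λ η s f → η :* (s :* f) := s :* (η :* f)) refl
    term : ∀ v → η * (s v * F v) ≤ s v * H v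
    term v with P? v
    ... | yes Pv = ≤-trans (≤-reflexive (swap η (s v) (F v)))
                     (*-monoˡ-≤-nonNeg (s v) {{nonNegative (0≤s v)}} (ηF≤H v Pv))
    ... | no ¬Pv rewrite s≡0 v ¬Pv | *-zeroˡ (F v) | *-zeroˡ (H v) = ≤-reflexive (*-zeroʳ η)
    average : η * a ≤ sum (λ v → s v * H v)
    average = ≤-trans (≤-reflexive (*-distribˡ-sum η (λ v → s v * F v))) (sum-mono-≤ term)

  -- With M the maximum of F and m = (1 - e) a + e M, put η = z/m.  The AM-GM
  -- inequality gives η ≤ M ^ -e, hence η F v ≤ F v ^ (1 - e) ≤ H v for all
  -- v in P, and averaging these gives z = η m ≤ biased.
  biased-bound : ∀ c → P c → (∀ v → P v → F v ≤ F c) → 0ℚ < a →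
    ∀ {z} → 0ℚ < z → z ^ b ≤ a ^ k → z ≤ biased (just c)
  biased-bound c Pc F≤M 0<a {z} 0<z zᵇ≤aᵏ = by-scale (scale 0<m 0<z)
    where
    m : ℚ
    m = (1ℚ - e) * a + e * F c
    0<m : 0ℚ < m
    0<m = <-≤-trans 0<a (≤-mean 0≤e (a≤ (0≤p c) F≤M))
    by-scale : ∃[ η ] 0ℚ < η × m * η ≡ z → z ≤ biased (just c)
    by-scale (η , 0<η , mη≡z) = subst (_≤ biased (just c)) mη≡z (biased-lower c Pc λ v Pv →
      scaled-≤ k l (F≼H v) (<⇒≤ 0<η) (F≤M v Pv)
        (scale-bound k l (0≤p c) 0<m mη≡z zᵇ≤aᵏ (weighted-amgm k l be≡l 0≤a (0≤p c))))

  dominates : ∀ {m} → IsMaximiser P F m → Dominates k l a (biased m)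
  dominates {m} max = record
    { 0≤p   = 0≤a
    ; p≤1   = a≤ 0≤1 (λ v _ → p≤1 v)
    ; 0≤q   = 0≤biased m
    ; bound = bnd m max }
    where
    bnd : ∀ m → IsMaximiser P F m → 0ℚ < a → ∀ {z} → 0ℚ ≤ z → z ^ b ≤ a ^ k → z ≤ biased m
    -- Without neighbours, 0 is vacuously an upper bound for F on P, so a ≤ 0.
    bnd nothing none 0<a =
      contradiction (<-≤-trans 0<a (a≤ ≤-refl (λ v Pv → contradiction Pv (none v)))) (<-irrefl refl)
    -- A positive z is needed for a positive η = z/m; z = 0 is covered by nonnegativity.
    bnd (just c) (Pc , F≤Fc) 0<a {z} 0≤z h with 0ℚ <? z
    ... | yes 0<z = biased-bound c Pc F≤Fc 0<a 0<z h
    ... | no  0≮z = ≤-trans (≮⇒≥ 0≮z) (0≤biased (just c))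

-- Probabilities by backward recursion

module Walk {n : ℕ} where
  open Process +-*-rawSemiring {n}

  sumVec-cong : ∀ m {f g : Vec (Fin n) m → ℚ} → (∀ x → f x ≡ g x) → sumVec m f ≡ sumVec m g
  sumVec-cong zero    f≡g = f≡g []
  sumVec-cong (suc m) f≡g = sum-cong-≗ λ v → sumVec-cong m λ x → f≡g (v ∷ x)

  -- `sumVec` splits off the first entry while `pathProb` splits off the last; this reconciles the
  -- two.
  sumVec-∷ʳ : ∀ m (f : Vec (Fin n) (suc m) → ℚ) →
    sumVec (suc m) f ≡ sumVec m λ x → sum λ v → f (x ∷ʳ v)
  sumVec-∷ʳ zero    f = refl
  sumVec-∷ʳ (suc m) f = sum-cong-≗ λ v → sumVec-∷ʳ m λ x → f (v ∷ x)

  module _ (step : StepRule ℚ n) where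

    -- the conditional expectation of f (j + i) given the first i steps
    value : (∀ i → Vec (Fin n) (suc i) → ℚ) → ℕ → ∀ i → Vec (Fin n) (suc i) → ℚ
    value f zero    i h = f i h
    value f (suc j) i h = sum λ v → step i h v * value f j (suc i) (h ∷ʳ v)

    expectation : Fin n → ∀ t → (Vec (Fin n) (suc t) → ℚ) → ℚ
    expectation u t f = sumVec (suc t) λ x → pathProb step u t x * f x

    expectation-suc : ∀ u t f → expectation u (suc t) f ≡
      expectation u t (λ h → sum λ v → step t h v * f (h ∷ʳ v))
    expectation-suc u t f = trans
      (sumVec-∷ʳ (suc t) λ x → pathProb step u (suc t) x * f x)
      (sumVec-cong (suc t) λ h → trans (sum-cong-≗ (term h))
        (sym (*-distribˡ-sum (pathProb step u t h) λ v → step t h v * f (h ∷ʳ v))))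
      where
      term : ∀ h v → pathProb step u (suc t) (h ∷ʳ v) * f (h ∷ʳ v)
                   ≡ pathProb step u t h * (step t h v * f (h ∷ʳ v))
      term h v rewrite init-∷ʳ v h | last-∷ʳ v h = *-assoc (pathProb step u t h) (step t h v) _

    -- Tower property: each induction step trades the last step of the walk for one more layer of
    -- `value`. At time 0 the path probability is the point mass at u.
    expectation-value : ∀ f u i j → expectation u i (value f j i) ≡ value f (i ℕ.+ j) 0 (u ∷ [])
    expectation-value f u zero    j = sum-pointMass-* u λ v → value f j 0 (v ∷ [])
    expectation-value f u (suc i) j = trans (expectation-suc u i (value f j (suc i)))
      (trans (expectation-value f u i (suc j))
        (cong (λ m → value f m 0 (u ∷ [])) (ℕₚ.+-suc i j)))

    module _ {t} {S : Pred (Vec (Fin n) (suc t)) 0ℓ} (S? : Decidable S) where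

      prob≡expectation : ∀ u →
        prob step u t S? ≡ expectation u t (λ x → if does (S? x) then 1ℚ else 0ℚ)
      prob≡expectation u = sumVec-cong (suc t) term
        where
        term : ∀ x → (if does (S? x) then pathProb step u t x else 0ℚ)
                   ≡ pathProb step u t x * (if does (S? x) then 1ℚ else 0ℚ)
        term x with does (S? x)
        ... | true  = sym (*-identityʳ (pathProb step u t x))
        ... | false = sym (*-zeroʳ (pathProb step u t x))

  -- Histories of a length other than that of the trajectories get the junk value 0.
  indicator : ∀ {t} {S : Pred (Vec (Fin n) (suc t)) 0ℓ} → Decidable S → ∀ i → Vec (Fin n) (suc i) → ℚ
  indicator {t} S? i x with i ℕₚ.≟ t
  ... | yes refl = if does (S? x) then 1ℚ else 0ℚ
  ... | no  _    = 0ℚ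

  indicator-here : ∀ {t} {S : Pred (Vec (Fin n) (suc t)) 0ℓ} (S? : Decidable S) x →
    indicator S? t x ≡ (if does (S? x) then 1ℚ else 0ℚ)
  indicator-here {t} S? x rewrite ℕₚ.≟-diag {t} refl = refl

  prob≡value : ∀ step u {t} {S : Pred (Vec (Fin n) (suc t)) 0ℓ} (S? : Decidable S) →
    prob step u t S? ≡ value step (indicator S?) t 0 (u ∷ [])
  prob≡value step u {t} S? = begin
    prob step u t S?                                                ≡⟨ prob≡expectation step S? u ⟩
    expectation step u t (λ x → if does (S? x) then 1ℚ else 0ℚ)     ≡⟨ sumVec-cong (suc t) (λ x → cong (pathProb step u t x *_) (sym (indicator-here S? x))) ⟩
    expectation step u t (value step (indicator S?) 0 t)            ≡⟨ expectation-value step (indicator S?) u t 0 ⟩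
    value step (indicator S?) (t ℕ.+ 0) 0 (u ∷ [])                  ≡⟨ cong (λ m → value step (indicator S?) m 0 (u ∷ [])) (ℕₚ.+-identityʳ t) ⟩
    value step (indicator S?) t 0 (u ∷ [])                          ∎
    where open ≡-Reasoning

  -- The start of the backward induction: the final values are 0 and 1, and each dominates itself
  -- for all exponents.
  indicator-dominates : ∀ k l .{{_ : ℕ.NonZero (k ℕ.+ l)}} {t} {S : Pred (Vec (Fin n) (suc t)) 0ℓ}
    (S? : Decidable S) i x → Dominates k l (indicator S? i x) (indicator S? i x)
  indicator-dominates k l {t} S? i x with i ℕₚ.≟ t
  ... | no  _    = dominates-0 k l
  ... | yes refl with does (S? x)
  ...   | true  = dominates-1 k l
  ...   | false = dominates-0 k l

-- The greedy controller at rational bias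

module Greedy {n : ℕ} (G : SimpleGraph n)
  {t : ℕ} {S : Pred (Vec (Fin n) (suc t)) 0ℓ} (S? : Decidable S) where
  open SimpleGraph G
  open Walk {n}

  srw-nonneg : ∀ i h v → 0ℚ ≤ srwStep G i h v
  srw-nonneg i h v with does (adj? (last h) v) | degree (last h)
  ... | false | _     = ≤-refl
  ... | true  | zero  = ≤-refl
  ... | true  | suc d = 0≤/ 1 d

  srw-support : ∀ i h v → ¬ Adj (last h) v → srwStep G i h v ≡ 0ℚ
  srw-support i h v ¬adj with adj? (last h) v
  ... | yes adj = contradiction adj ¬adj
  ... | no  _   = refl

  srw-total : ∀ i h → sum (srwStep G i h) ≤ 1ℚ
  srw-total i h = ≤-trans (≤-reflexive (sum-if (adj? (last h)) (λ v → v) (reciprocal (degree (last h)))))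
    (d*1/d≤1 (degree (last h)))
    where
    d*1/d≤1 : ∀ d → fromℕ d * reciprocal d ≤ 1ℚ
    d*1/d≤1 zero    = 0≤1
    d*1/d≤1 (suc d) = ≤-reflexive (trans (sym (/-as-* (suc d) d)) (n/n d))

  srwValue : ℕ → ∀ i → Vec (Fin n) (suc i) → ℚ
  srwValue = value (srwStep G) (indicator S?)

  -- After the move at time i there remain t - (i + 1) steps. The truncation of `∸` only concerns i
  -- ≥ t, after the walk has ended.
  choice : ∀ i (h : Vec (Fin n) (suc i)) →
    ∃[ m ] IsMaximiser (Adj (last h)) (λ v → srwValue (t ℕ.∸ suc i) (suc i) (h ∷ʳ v)) m
  choice i h = maximiser (adj? (last h)) (λ v → srwValue (t ℕ.∸ suc i) (suc i) (h ∷ʳ v))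

  move : ∀ i → Vec (Fin n) (suc i) → Maybe (Fin n)
  move i h = proj₁ (choice i h)

  biasedStep : ℚ → StepRule ℚ n
  biasedStep e i h v = (1ℚ - e) * srwStep G i h v + e * mass (move i h) v

  module _ (k l : ℕ) .{{_ : ℕ.NonZero (k ℕ.+ l)}} {e : ℚ}
    (be≡l : fromℕ (k ℕ.+ l) * e ≡ fromℕ l) (0≤e : 0ℚ ≤ e) (e≤1 : e ≤ 1ℚ) where

    -- Induction on the number j of remaining steps, with `BiasedAverage.dominates` going one step
    -- back.
    value-dominates : ∀ j i h → j ℕ.+ i ≡ t →
      Dominates k l (srwValue j i h) (value (biasedStep e) (indicator S?) j i h)
    value-dominates zero    i h _     = indicator-dominates k l S? i h
    value-dominates (suc j) i h j+i≡t = BiasedAverage.dominates k l be≡l 0≤e e≤1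
      (srwStep G i h) (srw-nonneg i h) (srw-support i h) (adj? (last h)) (srw-total i h)
      (λ v → value-dominates j (suc i) (h ∷ʳ v) (trans (ℕₚ.+-suc j i) j+i≡t))
      {move i h}
      -- `choice` looks t ∸ suc i steps ahead, which is j because suc j + i = t.
      (subst (λ m → IsMaximiser (Adj (last h)) (λ v → srwValue m (suc i) (h ∷ʳ v)) (move i h))
        (trans (cong (ℕ._∸ suc i) (sym (trans (ℕₚ.+-suc j i) j+i≡t))) (ℕₚ.m+n∸n≡m j (suc i)))
        (proj₂ (choice i h)))

    prob-dominates : ∀ u → Dominates k l (srwProb G u t S?) (Process.prob +-*-rawSemiring (biasedStep e) u t S?)
    prob-dominates u = subst₂ (Dominates k l)
      (sym (prob≡value (srwStep G) u S?)) (sym (prob≡value (biasedStep e) u S?))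
      (value-dominates t 0 (u ∷ []) (ℕₚ.+-identityʳ t))

-- From integer exponents to the approximants of a real power

fromℕ-cancel-≤ : ∀ m n → fromℕ m ≤ fromℕ n → m ℕ.≤ n
fromℕ-cancel-≤ m n h with m ℕₚ.≤? n
... | yes m≤n = m≤n
... | no  m≰n = contradiction
  (<-≤-trans (subst₂ _<_ (+-identityʳ (fromℕ n)) (sym (fromℕ-suc n)) (+-monoʳ-< (fromℕ n) 0<1))
    (≤-trans (fromℕ-mono (ℕₚ.≰⇒> m≰n)) h))
  (<-irrefl refl)

denominator-* : ∀ {r} → 0ℚ ≤ r → fromℕ (↧ₙ r) * r ≡ fromℕ ℤ.∣ ↥ r ∣
denominator-* {r@(mkℚ (ℤ.+ a) d-1 _)} _ = begin
  fromℕ d * r                            ≡⟨ cong (fromℕ d *_) (trans (sym (↥p/↧p≡p r)) (/-as-* a d-1)) ⟩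
  fromℕ d * (fromℕ a * (ℤ.+ 1 / d))      ≡⟨ swap (fromℕ d) (fromℕ a) (ℤ.+ 1 / d) ⟩
  fromℕ a * (fromℕ d * (ℤ.+ 1 / d))      ≡⟨ cong (fromℕ a *_) (trans (sym (/-as-* d d-1)) (n/n d-1)) ⟩
  fromℕ a * 1ℚ                           ≡⟨ *-identityʳ (fromℕ a) ⟩
  fromℕ a                                ∎
  where
  open ≡-Reasoning
  d = suc d-1
  swap : ∀ x y z → x * (y * z) ≡ y * (x * z)
  swap = solve 3 (λ x y z → x :* (y :* z) := y :* (x :* z)) refl
denominator-* {mkℚ ℤ.-[1+ _ ] _ _} 0≤r = contradiction (drop-*≤* 0≤r) λ { () }

^-antitone : ∀ {p i j} → 0ℚ ≤ p → p ≤ 1ℚ → i ℕ.≤ j → p ^ j ≤ p ^ i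
^-antitone {p} {i} {j} 0≤p p≤1 i≤j = begin
  p ^ j                 ≡⟨ cong (p ^_) (sym (ℕₚ.m+[n∸m]≡n i≤j)) ⟩
  p ^ (i ℕ.+ d)         ≡⟨ ^-homo-* p i d ⟩
  p ^ i * p ^ d         ≤⟨ *-monoˡ-≤-nonNeg (p ^ i) {{nonNegative (^-nonneg i 0≤p)}} (^-mono-≤ d 0≤p p≤1) ⟩
  p ^ i * 1ℚ ^ d        ≡⟨ trans (cong (p ^ i *_) (1^ d)) (*-identityʳ (p ^ i)) ⟩
  p ^ i                 ∎
  where
  open ≤-Reasoning
  d = j ℕ.∸ i

-- The terms of a sequence representing ε ∈ [0, 1] may lie outside [0, 1].
clamp : ℚ → ℚ
clamp e = 0ℚ ⊔ (1ℚ - (0ℚ ⊔ (1ℚ - e)))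

module _ {p} {q : ℚ → ℚ}
  (p≼q : ∀ k l .{{_ : ℕ.NonZero (k ℕ.+ l)}} {e} → fromℕ (k ℕ.+ l) * e ≡ fromℕ l →
    0ℚ ≤ e → e ≤ 1ℚ → Dominates k l p (q e))
  where

  -- An exponent r > 1 is replaced by 1, which is harmless because p ≤ 1.
  dominates-exponent : ∀ {r} → 0ℚ ≤ r → ∃[ k ] ∃[ l ] Dominates k l p (q (0ℚ ⊔ (1ℚ - r)))
    × (∀ {z} → 0ℚ ≤ z → z ^ ↧ₙ r ≤ p ^ ℤ.∣ ↥ r ∣ → z ^ (k ℕ.+ l) ≤ p ^ k)
  dominates-exponent {r} 0≤r with ≤-total r 1ℚ
  ... | inj₁ r≤1 = k , l
      , subst (λ e → Dominates k l p (q e)) (sym (p≤q⇒p⊔q≡q 0≤1-r)) (p≼q k l be≡l 0≤1-r 1-r≤1)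
      , λ {z} _ → subst (λ i → z ^ i ≤ p ^ k) (sym k+l≡b)
    where
    k b l : ℕ
    k = ℤ.∣ ↥ r ∣
    b = ↧ₙ r
    -- For r = k/b ≤ 1 this gives k + l = b and 1 - r = l/(k + l).
    l = b ℕ.∸ k
    0≤1-r : 0ℚ ≤ 1ℚ - r
    0≤1-r = p≤q⇒0≤q-p r≤1
    1-r≤1 : 1ℚ - r ≤ 1ℚ
    1-r≤1 = subst (1ℚ - r ≤_) (solve 1 (λ r → con 1ℚ :- r :+ r := con 1ℚ) refl r) (≤+ʳ 0≤r)
    k≤b : k ℕ.≤ b
    k≤b = fromℕ-cancel-≤ k b (subst₂ _≤_ (denominator-* 0≤r) (*-identityʳ (fromℕ b))
      (*-monoˡ-≤-nonNeg (fromℕ b) {{nonNegative (0≤/ b 0)}} r≤1))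
    k+l≡b : k ℕ.+ l ≡ b
    k+l≡b = ℕₚ.m+[n∸m]≡n k≤b
    instance
      k+l≢0 : ℕ.NonZero (k ℕ.+ l)
      k+l≢0 = subst ℕ.NonZero (sym k+l≡b) _
    be≡l : fromℕ (k ℕ.+ l) * (1ℚ - r) ≡ fromℕ l
    be≡l = begin
      fromℕ (k ℕ.+ l) * (1ℚ - r)           ≡⟨ cong (λ i → fromℕ i * (1ℚ - r)) k+l≡b ⟩
      fromℕ b * (1ℚ - r)                   ≡⟨ expand (fromℕ b) r ⟩
      fromℕ b - fromℕ b * r                ≡⟨ cong₂ _-_ (trans (cong fromℕ (sym k+l≡b)) (fromℕ-+ k l)) (denominator-* 0≤r) ⟩
      fromℕ k + fromℕ l - fromℕ k          ≡⟨ cancel (fromℕ k) (fromℕ l) ⟩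
      fromℕ l                              ∎
      where
      open ≡-Reasoning
      expand : ∀ b r → b * (1ℚ - r) ≡ b - b * r
      expand = solve 2 (λ b r → b :* (con 1ℚ :- r) := b :- b :* r) refl
      cancel : ∀ k l → k + l - k ≡ l
      cancel = solve 2 (λ k l → k :+ l :- k := l) refl
  ... | inj₂ 1≤r = 1 , 0
      , subst (λ e → Dominates 1 0 p (q e)) (sym (p≥q⇒p⊔q≡p 1-r≤0)) p≼q₀
      -- Since b ≤ k and p ≤ 1, z^b ≤ p^k ≤ p^b, whence z ≤ p.
      , λ 0≤z zᵇ≤pᵏ → ^-mono-≤ 1 0≤z
          (^-cancel-≤ b 0≤p (≤-trans zᵇ≤pᵏ (^-antitone 0≤p p≤1 b≤k)))
    where
    p≼q₀ : Dominates 1 0 p (q 0ℚ)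
    p≼q₀ = p≼q 1 0 refl ≤-refl 0≤1
    open Dominates p≼q₀ using (0≤p; p≤1)
    k b : ℕ
    k = ℤ.∣ ↥ r ∣
    b = ↧ₙ r
    1-r≤0 : 1ℚ - r ≤ 0ℚ
    1-r≤0 = subst (1ℚ - r ≤_) (+-inverseʳ r) (+-monoˡ-≤ (- r) 1≤r)
    b≤k : b ℕ.≤ k
    b≤k = fromℕ-cancel-≤ b k (subst₂ _≤_ (*-identityʳ (fromℕ b)) (denominator-* 0≤r)
      (*-monoˡ-≤-nonNeg (fromℕ b) {{nonNegative (0≤/ b 0)}} 1≤r))

  0≤q∘clamp : ∀ e → 0ℚ ≤ q (clamp e)
  0≤q∘clamp e =
    let _ , _ , D , _ = dominates-exponent (p≤p⊔q 0ℚ (1ℚ - e))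
    in Dominates.0≤q D

  -- Both sides involve the same r = 0 ⊔ (1 - e), as `clamp e` is 0 ⊔ (1 - r). Being rounded down,
  -- the approximant is a rational z whose b-th power is at most p^k, for r = k/b, which is what
  -- `bound` accepts.
  powApprox-≤ : 0ℚ < p → ∀ n e → powApprox n p (0ℚ ⊔ (1ℚ - e)) ≤ q (clamp e)
  powApprox-≤ 0<p n e =
    let r = 0ℚ ⊔ (1ℚ - e)
        k = ℤ.∣ ↥ r ∣
        _ , _ , D , convert = dominates-exponent (p≤p⊔q 0ℚ (1ℚ - e))
        0≤z = rootApprox-nonneg n (↧ₙ r) (p ^ k)
    in Dominates.bound D 0<p 0≤z
         (convert 0≤z (rootApprox-lower n (↧ₙ r) (p ^ k) (^-nonneg k (<⇒≤ 0<p))))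

-- Follows the case split in `_^ᴿ_`: unless p > 0 the power is 0, also for exponent 0, and
-- nonnegativity is enough.
^ᴿ-pointwise-≤ : ∀ p y {x : ℕ → ℚ} → (∀ n → 0ℚ ≤ x n) →
  (0ℚ < p → ∀ n → powApprox n p (0ℚ ⊔ seq y n) ≤ x n) → ∀ n → seq (p ^ᴿ y) n ≤ x n
^ᴿ-pointwise-≤ p y 0≤x h n with 0ℚ <? p
... | yes 0<p = h 0<p n
... | no  _   = 0≤x n

-- Congruence for real arithmetic and the terms of real probabilities

infix 4 _≃_

-- Equivalent to `_≈ᴿ_`, but in a form to which the triangle inequality applies directly.
_≃_ : ℝ → ℝ → Set
x ≃ y = ∀ {δ} → 0ℚ < δ → ∃[ N ] ∀ n → N ℕ.≤ n → ∣ seq x n - seq y n ∣ ≤ δ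

≃-refl : ∀ x → x ≃ x
≃-refl x 0<δ = 0 , λ n _ → ≤⇒near {seq x n} {seq x n} (≤+ʳ (<⇒≤ 0<δ)) (≤+ʳ (<⇒≤ 0<δ))

+-cong : ∀ {x x′ y y′} → x ≃ x′ → y ≃ y′ → x +ᴿ y ≃ x′ +ᴿ y′
+-cong {x} {x′} {y} {y′} x≃ y≃ {δ} 0<δ =
  let N₁ , c₁ = x≃ (half-pos 0<δ)
      N₂ , c₂ = y≃ (half-pos 0<δ)
  in N₁ ℕ.⊔ N₂ , λ n n≥ → subst₂ _≤_
    (cong ∣_∣ (regroup (seq x n) (seq x′ n) (seq y n) (seq y′ n)))
    (½+½ δ)
    (≤-trans (∣p+q∣≤∣p∣+∣q∣ (seq x n - seq x′ n) (seq y n - seq y′ n))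
      (+-mono-≤ (c₁ n (ℕₚ.m⊔n≤o⇒m≤o N₁ N₂ n≥)) (c₂ n (ℕₚ.m⊔n≤o⇒n≤o N₁ N₂ n≥))))
  where
  regroup : ∀ a b c d → (a - b) + (c - d) ≡ (a + c) - (b + d)
  regroup = solve 4 (λ a b c d → (a :- b) :+ (c :- d) := (a :+ c) :- (b :+ d)) refl

neg-cong : ∀ {x x′} → x ≃ x′ → -ᴿ x ≃ -ᴿ x′
neg-cong {x} {x′} x≃ {δ} 0<δ =
  let N , c = x≃ 0<δ
  in N , λ n n≥ → subst (_≤ δ)
    (trans (sym (∣-p∣≡∣p∣ (seq x n - seq x′ n))) (cong ∣_∣ (distrib (seq x n) (seq x′ n)))) (c n n≥)
  where
  distrib : ∀ a b → - (a - b) ≡ (- a) - (- b)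
  distrib = solve 2 (λ a b → :- (a :- b) := (:- a) :- (:- b)) refl

-- From xy - x′y′ = x (y - y′) + y′ (x - x′), with x and y′ eventually bounded by K and L and the
-- two differences by δ/(2K) and δ/(2L).
*-cong : ∀ {x x′ y y′} → x ≃ x′ → y ≃ y′ → x *ᴿ y ≃ x′ *ᴿ y′
*-cong {x} {x′} {y} {y′} x≃ y≃ {δ} 0<δ =
  let K , 0<K , N₁ , bx = eventually-bounded x
      L , 0<L , N₂ , by = eventually-bounded y′
      η , 0<η , Kη≡ = scale 0<K (half-pos 0<δ)
      θ , 0<θ , Lθ≡ = scale 0<L (half-pos 0<δ)
      N₃ , cy = y≃ 0<η
      N₄ , cx = x≃ 0<θ
  in (N₁ ℕ.⊔ N₂) ℕ.⊔ (N₃ ℕ.⊔ N₄) , λ n n≥ →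
    let n≥₁₂ = ℕₚ.m⊔n≤o⇒m≤o (N₁ ℕ.⊔ N₂) (N₃ ℕ.⊔ N₄) n≥
        n≥₃₄ = ℕₚ.m⊔n≤o⇒n≤o (N₁ ℕ.⊔ N₂) (N₃ ℕ.⊔ N₄) n≥
    in subst₂ _≤_
      (cong ∣_∣ (regroup (seq x n) (seq x′ n) (seq y n) (seq y′ n)))
      (trans (cong₂ _+_ Kη≡ Lθ≡) (½+½ δ))
      (≤-trans (∣p+q∣≤∣p∣+∣q∣ (seq x n * (seq y n - seq y′ n)) (seq y′ n * (seq x n - seq x′ n)))
        (+-mono-≤
          (∣*∣-≤ (seq x n) (seq y n - seq y′ n) (bx n (ℕₚ.m⊔n≤o⇒m≤o N₁ N₂ n≥₁₂)) (cy n (ℕₚ.m⊔n≤o⇒m≤o N₃ N₄ n≥₃₄)))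
          (∣*∣-≤ (seq y′ n) (seq x n - seq x′ n) (by n (ℕₚ.m⊔n≤o⇒n≤o N₁ N₂ n≥₁₂)) (cx n (ℕₚ.m⊔n≤o⇒n≤o N₃ N₄ n≥₃₄)))))
  where
  regroup : ∀ a b c d → a * (c - d) + d * (a - b) ≡ a * c - b * d
  regroup = solve 4 (λ a b c d → a :* (c :- d) :+ d :* (a :- b) := a :* c :- b :* d) refl
  ∣*∣-≤ : ∀ p q {K η} → ∣ p ∣ ≤ K → ∣ q ∣ ≤ η → ∣ p * q ∣ ≤ K * η
  ∣*∣-≤ p q {K} {η} p≤ q≤ = subst (_≤ K * η) (sym (∣p*q∣≡∣p∣*∣q∣ p q))
    (*-mono-≤ (0≤∣p∣ p) (0≤∣p∣ q) p≤ q≤)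

sum-cong : ∀ {n} {f g : Fin n → ℝ} → (∀ i → f i ≃ g i) → sumᴿ f ≃ sumᴿ g
sum-cong {zero}  f≃g = ≃-refl 0ᴿ
sum-cong {suc n} {f} {g} f≃g =
  +-cong {f zero} {g zero} {sumᴿ (f ∘ suc)} {sumᴿ (g ∘ suc)} (f≃g zero) (sum-cong (λ i → f≃g (suc i)))

seq-sum : ∀ {m} (f : Fin m → ℝ) n → seq (sumᴿ f) n ≡ sum λ i → seq (f i) n
seq-sum {zero}  f n = refl
seq-sum {suc m} f n = cong (_+_ (seq (f zero) n)) (seq-sum (f ∘ suc) n)

module _ {N : ℕ} where
  open Process ℝ-rawSemiring {N} using () renaming (sumVec to sumVecᴿ; pathProb to pathProbᴿ; prob to probᴿ)
  open Process +-*-rawSemiring {N}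

  sumVecᴿ-cong : ∀ m {f g : Vec (Fin N) m → ℝ} → (∀ x → f x ≃ g x) → sumVecᴿ m f ≃ sumVecᴿ m g
  sumVecᴿ-cong zero    f≃g = f≃g []
  sumVecᴿ-cong (suc m) f≃g = sum-cong λ v → sumVecᴿ-cong m λ x → f≃g (v ∷ x)

  seq-sumVec : ∀ m (f : Vec (Fin N) m → ℝ) n → seq (sumVecᴿ m f) n ≡ sumVec m λ x → seq (f x) n
  seq-sumVec zero    f n = refl
  seq-sumVec (suc m) f n = trans (seq-sum (λ v → sumVecᴿ m λ x → f (v ∷ x)) n)
    (sum-cong-≗ λ v → seq-sumVec m (λ x → f (v ∷ x)) n)

  module _ {step step′ : StepRule ℝ N} (step≃ : ∀ i h v → step i h v ≃ step′ i h v) (u : Fin N) where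

    pathProb-cong : ∀ t x → pathProbᴿ step u t x ≃ pathProbᴿ step′ u t x
    pathProb-cong zero    x = ≃-refl (pathProbᴿ step u zero x)
    pathProb-cong (suc t) x = *-cong
      {pathProbᴿ step u t (init x)} {pathProbᴿ step′ u t (init x)}
      {step t (init x) (last x)} {step′ t (init x) (last x)}
      (pathProb-cong t (init x)) (step≃ t (init x) (last x))

    prob-cong : ∀ t {S : Pred (Vec (Fin N) (suc t)) 0ℓ} (S? : Decidable S) →
      probᴿ step u t S? ≃ probᴿ step′ u t S?
    prob-cong t S? = sumVecᴿ-cong (suc t)
      {λ x → if does (S? x) then pathProbᴿ step u t x else 0ᴿ}
      {λ x → if does (S? x) then pathProbᴿ step′ u t x else 0ᴿ} term
      where
      term : ∀ x → (if does (S? x) then pathProbᴿ step u t x else 0ᴿ)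
                 ≃ (if does (S? x) then pathProbᴿ step′ u t x else 0ᴿ)
      term x with does (S? x)
      ... | true  = pathProb-cong t x
      ... | false = ≃-refl 0ᴿ

  module _ (step : StepRule ℝ N) (u : Fin N) (n : ℕ) where

    seqStep : StepRule ℚ N
    seqStep i h v = seq (step i h v) n

    seq-pathProb : ∀ t x → seq (pathProbᴿ step u t x) n ≡ pathProb seqStep u t x
    seq-pathProb zero x with does (head x Finₚ.≟ u)
    ... | true  = refl
    ... | false = refl
    seq-pathProb (suc t) x = cong (_* seqStep t (init x) (last x)) (seq-pathProb t (init x))

    -- A probability is a polynomial in the step weights and real arithmetic is termwise, so this
    -- holds even when the n-th terms are not themselves transition probabilities.
    seq-prob : ∀ t {S : Pred (Vec (Fin N) (suc t)) 0ℓ} (S? : Decidable S) →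
      seq (probᴿ step u t S?) n ≡ prob seqStep u t S?
    seq-prob t S? = trans (seq-sumVec (suc t) (λ x → if does (S? x) then pathProbᴿ step u t x else 0ᴿ) n)
      (Walk.sumVec-cong (suc t) term)
      where
      term : ∀ x → seq (if does (S? x) then pathProbᴿ step u t x else 0ᴿ) n
                 ≡ (if does (S? x) then pathProb seqStep u t x else 0ℚ)
      term x with does (S? x)
      ... | true  = seq-pathProb t x
      ... | false = refl

-- Clamping the bias to [0, 1]

0⊔ᴿ_ : ℝ → ℝ
0⊔ᴿ x = mkℝ (λ n → 0ℚ ⊔ seq x n) λ 0<δ →
  let N , c = cauchy x 0<δ
  in N , λ m n m≥ n≥ → ⊔-near (seq x m) (seq x n) (c m n m≥ n≥)

-- Built so that its terms are by definition `clamp` of the terms of ε.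
clampᴿ : ℝ → ℝ
clampᴿ ε = 0⊔ᴿ (1ᴿ -ᴿ (0⊔ᴿ (1ᴿ -ᴿ ε)))

-- Clamping moves e by its distance to [0, 1], and the hypotheses place e within δ of that interval.
clamp-near : ∀ {e δ} → 0ℚ ≤ δ → 0ℚ ≤ e + δ → e ≤ 1ℚ + δ → ∣ clamp e - e ∣ ≤ δ
clamp-near {e} {δ} 0≤δ 0≤e+δ e≤1+δ = ≤⇒near {clamp e} {e}
  (⊔-lub 0≤e+δ (≤-trans 1-r≤e (≤+ʳ 0≤δ)))
  (≤-trans e≤ (+-monoˡ-≤ δ (p≤q⊔p 0ℚ (1ℚ - r))))
  where
  r = 0ℚ ⊔ (1ℚ - e)
  1-r≤e : 1ℚ - r ≤ e
  1-r≤e = subst (1ℚ - r ≤_) (solve 1 (λ e → con 1ℚ :- (con 1ℚ :- e) := e) refl e)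
    (+-monoʳ-≤ 1ℚ (neg-antimono-≤ (p≤q⊔p 0ℚ (1ℚ - e))))
  r≤ : r ≤ 1ℚ - e + δ
  r≤ = ⊔-lub {_} {0ℚ} {1ℚ - e}
    (subst (0ℚ ≤_) (solve 2 (λ e δ → con 1ℚ :+ δ :- e := con 1ℚ :- e :+ δ) refl e δ) (p≤q⇒0≤q-p e≤1+δ))
    (≤+ʳ 0≤δ)
  e≤ : e ≤ 1ℚ - r + δ
  e≤ = +-cancelˡ-≤ (r - e) (subst₂ _≤_
    (solve 2 (λ r e → r := r :- e :+ e) refl r e)
    (solve 3 (λ r e δ → con 1ℚ :- e :+ δ := r :- e :+ (con 1ℚ :- r :+ δ)) refl r e δ) r≤)

clampᴿ-≃ : ∀ {ε} → 0ᴿ ≤ᴿ ε → ε ≤ᴿ 1ᴿ → clampᴿ ε ≃ ε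
clampᴿ-≃ {ε} 0≤ε ε≤1 0<δ =
  let N₁ , c₁ = 0≤ε 0<δ
      N₂ , c₂ = ε≤1 0<δ
  in N₁ ℕ.⊔ N₂ , λ n n≥ → clamp-near {seq ε n} (<⇒≤ 0<δ)
    (c₁ n (ℕₚ.m⊔n≤o⇒m≤o N₁ N₂ n≥)) (c₂ n (ℕₚ.m⊔n≤o⇒n≤o N₁ N₂ n≥))

pointwise-≡⇒≈ : ∀ {x y} → (∀ n → seq x n ≡ seq y n) → x ≈ᴿ y
pointwise-≡⇒≈ x≡y =
  (λ 0<δ → 0 , λ n _ → ≤-trans (≤-reflexive (x≡y n)) (≤+ʳ (<⇒≤ 0<δ))) ,
  (λ 0<δ → 0 , λ n _ → ≤-trans (≤-reflexive (sym (x≡y n))) (≤+ʳ (<⇒≤ 0<δ)))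

-- The greedy strategy at real bias

mass-support : ∀ {n} {P : Pred (Fin n) 0ℓ} {f} m → IsMaximiser P f m → ∀ v → ¬ P v → mass m v ≡ 0ℚ
mass-support nothing  _        v ¬Pv = refl
mass-support (just c) (Pc , _) v ¬Pv with v Finₚ.≟ c
... | yes refl = contradiction Pc ¬Pv
... | no  _    = refl

mass-total : ∀ {n} {P : Pred (Fin n) 0ℓ} {f} m → IsMaximiser P f m → ∀ v → P v → sum (mass m) ≡ 1ℚ
mass-total nothing  none v Pv = contradiction Pv (none v)
mass-total (just c) _    v Pv =
  trans (sum-cong-≗ λ w → sym (*-identityʳ (pointMass c w))) (sum-pointMass-* c (λ _ → 1ℚ))

module _ {n : ℕ} (G : SimpleGraph n)
  {t : ℕ} {S : Pred (Vec (Fin n) (suc t)) 0ℓ} (S? : Decidable S) where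
  open Greedy G S?

  greedyStrategy : Strategy G
  greedyStrategy = record
    { weight  = λ i h v → fromℚ (mass (move i h) v)
    ; nonneg  = λ i h v 0<δ → 0 , λ _ _ → ≤-trans (mass-nonneg (move i h) v) (≤+ʳ (<⇒≤ 0<δ))
    ; support = λ i h v ¬adj → pointwise-≡⇒≈ {fromℚ (mass (move i h) v)} {0ᴿ}
        λ _ → mass-support (move i h) (proj₂ (choice i h)) v ¬adj
    ; total   = λ i h v adj → pointwise-≡⇒≈ {sumᴿ (λ w → fromℚ (mass (move i h) w))} {1ᴿ}
        λ m → trans (seq-sum (λ w → fromℚ (mass (move i h) w)) m)
          (mass-total (move i h) (proj₂ (choice i h)) v adj)
    }

  -- The greedy weights and the simple random walk step are constant sequences, so only ε varies
  -- with m, and the m-th term of the step is `biasedStep (seq ε m)` by definition.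
  seq-tbrwProb : ∀ ε u m → seq (tbrwProb G ε greedyStrategy u t S?) m ≡
    Process.prob +-*-rawSemiring (biasedStep (seq ε m)) u t S?
  seq-tbrwProb ε u m = seq-prob (tbrwStep G ε greedyStrategy) u m t S?

  tbrwProb-cong : ∀ {ε ε′} → ε ≃ ε′ → ∀ u →
    tbrwProb G ε greedyStrategy u t S? ≃ tbrwProb G ε′ greedyStrategy u t S?
  tbrwProb-cong {ε} {ε′} ε≃ u = prob-cong step≃ u t S?
    where
    step≃ : ∀ i h v → tbrwStep G ε greedyStrategy i h v ≃ tbrwStep G ε′ greedyStrategy i h v
    step≃ i h v = +-cong {(1ᴿ -ᴿ ε) *ᴿ p} {(1ᴿ -ᴿ ε′) *ᴿ p} {ε *ᴿ w} {ε′ *ᴿ w}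
      (*-cong {1ᴿ -ᴿ ε} {1ᴿ -ᴿ ε′} {p} {p}
        (+-cong {1ᴿ} {1ᴿ} {(-ᴿ ε)} {(-ᴿ ε′)} (≃-refl 1ᴿ) (neg-cong {ε} {ε′} ε≃)) (≃-refl p))
      (*-cong {ε} {ε′} {w} {w} ε≃ (≃-refl w))
      where
      p w : ℝ
      p = fromℚ (srwStep G i h v)
      w = fromℚ (mass (move i h) v)

  -- Every term of the clamped bias is a rational in [0, 1], so the rational case applies at each
  -- index with no error term.
  power-≤-tbrwProb : ∀ ε u m →
    seq (srwProb G u t S? ^ᴿ (1ᴿ -ᴿ ε)) m ≤ seq (tbrwProb G (clampᴿ ε) greedyStrategy u t S?) m
  power-≤-tbrwProb ε u m = subst (seq (srwProb G u t S? ^ᴿ (1ᴿ -ᴿ ε)) m ≤_)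
    (sym (seq-tbrwProb (clampᴿ ε) u m))
    (^ᴿ-pointwise-≤ (srwProb G u t S?) (1ᴿ -ᴿ ε) {λ i → q (clamp (seq ε i))}
      (λ i → 0≤q∘clamp {q = q} p≼q (seq ε i))
      (λ 0<p i → powApprox-≤ {q = q} p≼q 0<p i (seq ε i))
      m)
    where
    q : ℚ → ℚ
    q e = Process.prob +-*-rawSemiring (biasedStep e) u t S?
    p≼q : ∀ k l .{{_ : ℕ.NonZero (k ℕ.+ l)}} {e} → fromℕ (k ℕ.+ l) * e ≡ fromℕ l →
      0ℚ ≤ e → e ≤ 1ℚ → Dominates k l (srwProb G u t S?) (q e)
    p≼q k l be≡l 0≤e e≤1 = prob-dominates k l be≡l 0≤e e≤1 u

theorem3p1 : ∀ {n : ℕ} (G : SimpleGraph n) → SimpleGraph.Connected G →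
    (u : Fin n) (t : ℕ) → 0 ℕ.< t →
    (ε : ℝ) → 0ᴿ ≤ᴿ ε → ε ≤ᴿ 1ᴿ →
    (S : Pred (Vec (Fin n) (suc t)) 0ℓ) (S? : Decidable S) →
    (∀ x → S x → SimpleGraph.IsTrajectory G u x) →
    Σ[ σ ∈ Strategy G ] (srwProb G u t S? ^ᴿ (1ᴿ -ᴿ ε)) ≤ᴿ tbrwProb G ε σ u t S?
theorem3p1 G _ u t _ ε 0≤ε ε≤1 S S? _ = greedyStrategy G S? , λ 0<δ →
  -- The termwise bound is for the clamped bias; returning to ε costs at most δ from index N on.
  let N , c = tbrwProb-cong G S? {clampᴿ ε} {ε} (clampᴿ-≃ {ε} 0≤ε ε≤1) u 0<δ
  in N , λ m m≥ → ≤-trans (power-≤-tbrwProb G S? ε u m) (near⇒≤ (c m m≥))
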